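{- Let $M=\begin{pmatrix} x_1 & x_2 & x_3\\ y_1 & y_2 & y_3\end{pmatrix}$ be an integer matrix with $\frac{y_1}{x_1}<\frac{y_2}{x_2}<\frac{y_3}{x_3}$, put $Y_{ij}=x_iy_j-x_jy_i$ for $i<j$, and suppose that $M$ is a 1-prime matrix. Let $f_{12},g_{12},f_{13},g_{13},f_{23},g_{23}\in\mathbb Z$ satisfy $$\gcd(f_{12}Y_{13}+g_{12}Y_{23},Y_{12})=1,\quad \gcd(f_{13}Y_{12}+g_{13}Y_{23},Y_{13})=1,\quad \gcd(f_{23}Y_{13}+g_{23}Y_{12},Y_{23})=1,$$ and let $(f_{12}Y_{13}+g_{12}Y_{23})^{ -1}$, $(f_{13}Y_{12}+g_{13}Y_{23})^{ -1}$, $(f_{23}Y_{13}+g_{23}Y_{12})^{ -1}$ denote integers that are inverses of the respective numbers modulo $Y_{12}$, $Y_{13}$, $Y_{23}$. When $\mathbf n=(n_1,n_2)^T\in\overline{\Omega}_1\cap\mathbb Z^2$, $$\begin{aligned} t(\mathbf n|M)=\ &\frac{n_2x_1-n_1y_1}{Y_{12}Y_{13}}-\left\{\frac{(f_{12}Y_{13}+g_{12}Y_{23})^{ -1}\bigl(n_2(f_{12}x_1+g_{12}x_2)-n_1(f_{12}y_1+g_{12}y_2)\bigr)}{Y_{12}}\right\}\\ &-\left\{\frac{(f_{13}Y_{12}+g_{13}Y_{23})^{ -1}\bigl(n_2(f_{13}x_1+g_{13}x_3)-n_1(f_{13}y_1+g_{13}y_3)\bigr)}{Y_{13}}\right\}+1.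 \end{aligned}$$ When $\mathbf n=(n_1,n_2)^T\in\overline{\Omega}_2\cap\mathbb Z^2$, $$\begin{aligned} t(\mathbf n|M)=\ &\frac{n_1y_3-n_2x_3}{Y_{23}Y_{13}}-\left\{\frac{(f_{23}Y_{13}+g_{23}Y_{12})^{ -1}\bigl(n_1(f_{23}x_3+g_{23}x_2)-n_2(f_{23}y_3+g_{23}y_2)\bigr)}{Y_{23}}\right\}\\ &-\left\{\frac{(f_{13}Y_{12}+g_{13}Y_{23})^{ -1}\bigl(n_1(f_{13}x_1+g_{13}x_3)-n_2(f_{13}y_1+g_{13}y_3)\bigr)}{Y_{13}}\right\}+1. \end{aligned}$$
   Context: For a $2\times 3$ integer matrix $M$ whose columns have convex hull not containing the origin, the vector partition function is $t(\mathbf b|M)=\#\{\mathbf x\in\mathbb Z_{\ge 0}^3 : M\mathbf x=\mathbf b\}$ for $\mathbf b\in\mathbb Z^2$. The $2\times 3$ matrix $M$ is 1-prime if the gcd of the absolute values of its nonzero $2\times 2$ minors is $1$. $\mathrm{cone}(M)$ is the set of nonnegative real combinations of the columns of $M$; $\Omega_1=\{(x,y)^T\in\mathrm{cone}(M): \frac{y_1}{x_1}<\frac yx<\frac{y_2}{x_2}\}$ and $\Omega_2=\{(x,y)^T\in\mathrm{cone}(M): \frac{y_2}{x_2}<\frac yx<\frac{y_3}{x_3}\}$, and the bar denotes closure. $\{x\}=x-\lfloor x\rfloor$ is the fractional part of $x$.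
   Formalization: The printed claim is false; corrected: in all 13 data Y23 becomes −Y23; in the second formula the 23 numerator is n1(f23y3+g23y2)−n2(f23x3+g23x2) and the 13 numerator is that of the first formula; x1, x2, x3 are assumed to have the same sign (it fails otherwise). -}

module Defs where

open import Algebra.Bundles.Raw using (RawSemiring)
open import Data.Fin.Base using (Fin)
open import Data.Fin.Patterns using (0F; 1F; 2F)
open import Data.Integer.Base as ℤ using (ℤ; +_; -[1+_]; 0ℤ; 1ℤ; _*_; _-_; -_; NonZero)
import Data.Integer.Properties as ℤ
open import Data.Integer.Divisibility.Signed using (_∣_)
open import Data.List.Base as List using (List)
open import Data.Nat.Base as ℕ using (ℕ; suc)
open import Data.Nat.GCD using (gcd)
import Data.Nat.Properties as ℕ
open import Data.Product.Base using (Σ; ∃; _×_)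
open import Data.Rational.Base as ℚ using (ℚ; 0ℚ; 1ℚ; _/_; floor)
import Data.Rational.Properties as ℚ
open import Data.Rational.Unnormalised.Base using (mkℚᵘ; *≡*)
open import Data.Vec.Base as Vec using (Vec; []; _∷_)
open import Data.Vec.Relation.Binary.Pointwise.Inductive using (Pointwise)
open import Data.Vec.Relation.Unary.All using (All)
open import Function.Bundles using (_↔_)
open import Level using (0ℓ)
open import Relation.Binary.PropositionalEquality
open import Relation.Nullary.Decidable using (¬?)
open import Relation.Unary using (Pred; _∈_)

ι : ℤ → ℚ
ι a = a / 1

-- The library's division of integers to a rational only accepts natural
-- denominators.
infixl 7 _⁄_

_⁄_ : (a d : ℤ) .{{_ : NonZero d}} → ℚ
a ⁄ (+ n)    = a / n
a ⁄ -[1+ n ] = (- a) / suc n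

-- q - ⌊q⌋ ∈ [0,1).  The library's fracPart is |q - truncate q|, which is
-- different for negative q.
frac : ℚ → ℚ
frac q = q ℚ.- ι (floor q)

-- A matrix is its vector of rows.
Matrix : Set → ℕ → ℕ → Set
Matrix A m n = Vec (Vec A n) m

module Multiplication (R : RawSemiring 0ℓ 0ℓ) where
  open RawSemiring R using (Carrier; 0#) renaming (_+_ to _⊕_; _*_ to _⊗_)

  sum : ∀ {n} → Vec Carrier n → Carrier
  sum = Vec.foldr′ _⊕_ 0#

  infixr 7 _*ᵥ_

  _*ᵥ_ : ∀ {m n} → Matrix Carrier m n → Vec Carrier n → Vec Carrier m
  M *ᵥ v = Vec.map (λ row → sum (Vec.zipWith _⊗_ row v)) M

module ℤᴹ = Multiplication ℤ.+-*-rawSemiring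
module ℚᴹ = Multiplication ℚ.+-*-rawSemiring

minor : ∀ {n} → Matrix ℤ 2 n → Fin n → Fin n → ℤ
minor (xs ∷ ys ∷ []) i j =
  Vec.lookup xs i * Vec.lookup ys j - Vec.lookup xs j * Vec.lookup ys i

OnePrime : Matrix ℤ 2 3 → Set
OnePrime M = List.foldr gcd 0 (List.filter (λ k → ¬? (k ℕ.≟ 0)) absMinors) ≡ 1
  where
  absMinors : List ℕ
  absMinors = List.map ℤ.∣_∣
    (minor M 0F 1F List.∷ minor M 0F 2F List.∷ minor M 1F 2F List.∷ List.[])

InverseMod : (h a m : ℤ) → Set
InverseMod h a m = m ∣ (h * a - 1ℤ)

Solution : ∀ {m n} → Matrix ℤ m n → Vec ℤ m → Set
Solution {n = n} M b = Σ (Vec ℕ n) λ x → M ℤᴹ.*ᵥ Vec.map +_ x ≡ b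

-- t(b|M) = k.  Equality of integer vectors is proof-irrelevant, so each
-- vector x is counted once.
PartitionCount : ∀ {m n} → Matrix ℤ m n → Vec ℤ m → ℕ → Set
PartitionCount M b k = Fin k ↔ Solution M b

-- Hulls, cones and closures are taken over ℚ instead of ℝ: as M has integer
-- entries, the rational points of the real hull, of the real cone and of
-- its sectors between rational slopes are exactly the ones described
-- here, and they are dense in the real sets; so the rational points of
-- the closures agree as well.

ConvexHull : ∀ {m n} → Matrix ℤ m n → Pred (Vec ℚ m) 0ℓ
ConvexHull {n = n} M v = Σ (Vec ℚ n) λ w →
  All (0ℚ ℚ.≤_) w × ℚᴹ.sum w ≡ 1ℚ × Vec.map (Vec.map ι) M ℚᴹ.*ᵥ w ≡ v

Cone : ∀ {m n} → Matrix ℤ m n → Pred (Vec ℚ m) 0ℓ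
Cone {n = n} M v = Σ (Vec ℚ n) λ w →
  All (0ℚ ℚ.≤_) w × Vec.map (Vec.map ι) M ℚᴹ.*ᵥ w ≡ v

Sector : ∀ {n} → Matrix ℤ 2 n → (s t : ℚ) → Pred (Vec ℚ 2) 0ℓ
Sector M s t (x ∷ y ∷ []) =
  (x ∷ y ∷ []) ∈ Cone M ×
  Σ (ℚ.NonZero x) λ x≢0 → let slope = (y ℚ.÷ x) {{x≢0}} in
  s ℚ.< slope × slope ℚ.< t

Closure : ∀ {m} → Pred (Vec ℚ m) 0ℓ → Pred (Vec ℚ m) 0ℓ
Closure S v = ∀ ε → 0ℚ ℚ.< ε →
  ∃ λ u → u ∈ S × Pointwise (λ a b → ℚ.∣ a ℚ.- b ∣ ℚ.< ε) u v

private
  move : ∀ i y → - i * y ≡ i * - y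
  move i y = trans (sym (ℤ.neg-distribˡ-* i y)) (ℤ.neg-distribʳ-* i y)

  /-cong : ∀ m y₁ n y₂ → + suc m * y₂ ≡ + suc n * y₁ → y₁ / suc m ≡ y₂ / suc n
  /-cong m y₁ n y₂ eq = ℚ.fromℚᵘ-cong {mkℚᵘ y₁ m} {mkℚᵘ y₂ n} (*≡* (begin
    y₁ * + suc n  ≡⟨ ℤ.*-comm y₁ (+ suc n) ⟩
    + suc n * y₁  ≡⟨ eq ⟨
    + suc m * y₂  ≡⟨ ℤ.*-comm (+ suc m) y₂ ⟩
    y₂ * + suc m  ∎))
    where open ≡-Reasoning

  ⁄-cong : ∀ x₁ y₁ x₂ y₂ .{{_ : NonZero x₁}} .{{_ : NonZero x₂}} →
           x₁ * y₂ ≡ x₂ * y₁ → y₁ ⁄ x₁ ≡ y₂ ⁄ x₂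
  ⁄-cong (+ suc m) y₁ (+ suc n) y₂ eq = /-cong m y₁ n y₂ eq
  ⁄-cong (+ suc m) y₁ -[1+ n ] y₂ eq = /-cong m y₁ n (- y₂) (begin
    + suc m * - y₂     ≡⟨ ℤ.neg-distribʳ-* (+ suc m) y₂ ⟨
    - (+ suc m * y₂)   ≡⟨ cong -_ eq ⟩
    - (-[1+ n ] * y₁)  ≡⟨ ℤ.neg-distribˡ-* -[1+ n ] y₁ ⟩
    + suc n * y₁       ∎)
    where open ≡-Reasoning
  ⁄-cong -[1+ m ] y₁ (+ suc n) y₂ eq = /-cong m (- y₁) n y₂ (begin
    + suc m * y₂       ≡⟨ ℤ.neg-distribˡ-* -[1+ m ] y₂ ⟨
    - (-[1+ m ] * y₂)  ≡⟨ cong -_ eq ⟩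
    - (+ suc n * y₁)   ≡⟨ ℤ.neg-distribʳ-* (+ suc n) y₁ ⟩
    + suc n * - y₁     ∎)
    where open ≡-Reasoning
  ⁄-cong -[1+ m ] y₁ -[1+ n ] y₂ eq = /-cong m (- y₁) n (- y₂)
    (trans (sym (move (+ suc m) y₂)) (trans eq (move (+ suc n) y₁)))

minor-nonZero : ∀ x₁ y₁ x₂ y₂ .{{_ : NonZero x₁}} .{{_ : NonZero x₂}} →
                y₁ ⁄ x₁ ℚ.< y₂ ⁄ x₂ → NonZero (x₁ * y₂ - x₂ * y₁)
minor-nonZero x₁ y₁ x₂ y₂ s<t = ℤ.≢-nonZero λ Y≡0 →
  ℚ.<-irrefl (⁄-cong x₁ y₁ x₂ y₂ (ℤ.i-j≡0⇒i≡j (x₁ * y₂) (x₂ * y₁) Y≡0)) s<t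

{-# OPTIONS --safe #-}

-- As the minors are coprime, the integer solutions of M c = n form a line
-- c + ℤ (Y₂₃, - Y₁₃, Y₁₂).  For n in the closure of Ω₁ start from the solution
-- with 0 ≤ c₃ < Y₁₂; then c₁ ≥ 0 automatically, so the nonnegative solutions have
-- the parameters 0 ≤ k ≤ ⌊c₂ / Y₁₃⌋, and t = c₂ / Y₁₃ - {c₂ / Y₁₃} + 1.  Now
-- n₂ x₁ - n₁ y₁ = c₂ Y₁₂ + c₃ Y₁₃ gives c₂ / Y₁₃, and c₃ mod Y₁₂ and c₂ mod Y₁₃
-- are obtained by inverting their coefficients in the determinants of n with
-- the columns.  On the closure of Ω₂ the roles of c₁ and c₃ are exchanged.

module Submission where

open import Defs
open import Data.Integer as ℤ using (ℤ; +_; 0ℤ; 1ℤ; _+_; _*_; _-_; -_; _<_; _≤_; NonZero)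
open import Data.Integer.GCD using (gcd)
open import Data.Integer.Properties using (i*j≢0)
open import Data.Product using (Σ; ∃; ∃₂; _×_; _,_; proj₁; proj₂)
open import Data.Rational as ℚ using (ℚ; mkℚ; 0ℚ; 1ℚ; floor; toℚᵘ)
open import Data.Rational.Properties using (<-trans)
open import Data.Vec as Vec using (Vec; []; _∷_; map; replicate)
open import Relation.Binary.PropositionalEquality
open import Relation.Unary using (Pred; _∈_; _∉_)

import Data.Integer.Properties as ℤ
open import Algebra.Properties.AbelianGroup ℤ.+-0-abelianGroup using (∙-cancelˡ)
open import Axiom.UniquenessOfIdentityProofs using (module Decidable⇒UIP)
open import Data.Fin.Base using (Fin; toℕ; fromℕ<)
import Data.Fin.Properties as Fin
import Data.Integer.DivMod as ℤ
open import Data.Integer.Divisibility.Signed using (_∣_; divides)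
open import Data.Integer.Tactic.RingSolver using (solve-∀)
open import Data.List.Base as List using ([]; _∷_)
open import Data.Nat.Base as ℕ using (ℕ; zero; suc)
import Data.Nat.GCD as ℕ
import Data.Nat.Properties as ℕ
import Data.Rational.Properties as ℚ
import Data.Rational.Solver as ℚ
import Data.Rational.Unnormalised.Base as ℚᵘ
open ℚᵘ using (mkℚᵘ; *≡*; *≤*; *<*)
import Data.Rational.Unnormalised.Properties as ℚᵘ
open import Data.Sum using (_⊎_; inj₁; inj₂)
import Data.Vec.Properties as Vec
open import Data.Vec.Relation.Binary.Pointwise.Inductive as Pointwise using ()
open import Data.Vec.Relation.Unary.All as All using ()
open import Function using (_∘_)
open import Function.Bundles using (_↔_; mk↔ₛ′)
open import Level using (0ℓ)
open import Relation.Nullary.Decidable using (¬?)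

-- What passes from a sector to its closure is only the weak sign of the determinants of `n` with
-- the two bounding columns. That passage rests on integrality: an approximation shows that such a
-- determinant exceeds -1, hence it is at least 0. The other obstacle is that the reduced solution
-- may have `c₂` negative. The signs of the determinants bound it below only by `- Y₁₃`, so the
-- floor can be -1 and the count 0. For this reason `t` is the quotient of `c₂ + Y₁₃` by `Y₁₃`: it
-- stays a natural number, and the empty case needs no separate treatment. The order of the slopes
-- makes the minors positive because the entries of the first row have a common sign. Both signs are
-- handled at once by multiplying with products such as `x₁ * x₂`, never with a single entry.

-- Integers, quotients and fractional parts inside ℚ.

toℚᵘ-ι : ∀ a → toℚᵘ (ι a) ℚᵘ.≃ mkℚᵘ a 0
toℚᵘ-ι a = ℚ.toℚᵘ-fromℚᵘ (mkℚᵘ a 0)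

ι-+ : ∀ a b → ι (a + b) ≡ ι a ℚ.+ ι b
ι-+ a b = ℚ.toℚᵘ-injective (begin
  toℚᵘ (ι (a + b))               ≈⟨ toℚᵘ-ι (a + b) ⟩
  mkℚᵘ (a + b) 0                 ≈⟨ *≡* (cong (_* + 1) (cong₂ _+_ (sym (ℤ.*-identityʳ a)) (sym (ℤ.*-identityʳ b)))) ⟩
  mkℚᵘ a 0 ℚᵘ.+ mkℚᵘ b 0         ≈⟨ ℚᵘ.+-cong (toℚᵘ-ι a) (toℚᵘ-ι b) ⟨
  toℚᵘ (ι a) ℚᵘ.+ toℚᵘ (ι b)     ≈⟨ ℚ.toℚᵘ-homo-+ (ι a) (ι b) ⟨
  toℚᵘ (ι a ℚ.+ ι b)             ∎)
  where open ℚᵘ.≃-Reasoning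

ι-* : ∀ a b → ι (a * b) ≡ ι a ℚ.* ι b
ι-* a b = ℚ.toℚᵘ-injective (begin
  toℚᵘ (ι (a * b))               ≈⟨ toℚᵘ-ι (a * b) ⟩
  mkℚᵘ a 0 ℚᵘ.* mkℚᵘ b 0         ≈⟨ ℚᵘ.*-cong (toℚᵘ-ι a) (toℚᵘ-ι b) ⟨
  toℚᵘ (ι a) ℚᵘ.* toℚᵘ (ι b)     ≈⟨ ℚ.toℚᵘ-homo-* (ι a) (ι b) ⟨
  toℚᵘ (ι a ℚ.* ι b)             ∎)
  where open ℚᵘ.≃-Reasoning

ι-neg : ∀ a → ι (- a) ≡ ℚ.- ι a
ι-neg a = ℚ.toℚᵘ-injective (begin
  toℚᵘ (ι (- a))     ≈⟨ toℚᵘ-ι (- a) ⟩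
  ℚᵘ.- mkℚᵘ a 0      ≈⟨ ℚᵘ.-‿cong (toℚᵘ-ι a) ⟨
  ℚᵘ.- toℚᵘ (ι a)    ≈⟨ ℚ.toℚᵘ-homo‿- (ι a) ⟨
  toℚᵘ (ℚ.- ι a)     ∎)
  where open ℚᵘ.≃-Reasoning

ι-- : ∀ a b → ι (a - b) ≡ ι a ℚ.- ι b
ι-- a b = trans (ι-+ a (- b)) (cong (ι a ℚ.+_) (ι-neg b))

ι-mono-< : ∀ {a b} → a < b → ι a ℚ.< ι b
ι-mono-< {a} {b} a<b = ℚ.toℚᵘ-cancel-< (begin-strict
  toℚᵘ (ι a)  ≃⟨ toℚᵘ-ι a ⟩
  mkℚᵘ a 0    <⟨ *<* (ℤ.*-monoʳ-<-pos (+ 1) a<b) ⟩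
  mkℚᵘ b 0    ≃⟨ toℚᵘ-ι b ⟨
  toℚᵘ (ι b)  ∎)
  where open ℚᵘ.≤-Reasoning

ι-mono-≤ : ∀ {a b} → a ≤ b → ι a ℚ.≤ ι b
ι-mono-≤ {a} {b} a≤b = ℚ.toℚᵘ-cancel-≤ (begin
  toℚᵘ (ι a)  ≃⟨ toℚᵘ-ι a ⟩
  mkℚᵘ a 0    ≤⟨ *≤* (ℤ.*-monoʳ-≤-nonNeg (+ 1) a≤b) ⟩
  mkℚᵘ b 0    ≃⟨ toℚᵘ-ι b ⟨
  toℚᵘ (ι b)  ∎)
  where open ℚᵘ.≤-Reasoning

ι-cancel-< : ∀ {a b} → ι a ℚ.< ι b → a < b
ι-cancel-< ιa<ιb = ℤ.≰⇒> λ b≤a → ℚ.<-irrefl refl (ℚ.<-≤-trans ιa<ιb (ι-mono-≤ b≤a))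

ι-positive : ∀ {d} → 0ℤ < d → ℚ.Positive (ι d)
ι-positive 0<d = ℚ.positive (ι-mono-< 0<d)

⁄-*-cancel : ∀ a d .{{_ : NonZero d}} → (a ⁄ d) ℚ.* ι d ≡ ι a
⁄-*-cancel a (+ suc n) = ℚ.toℚᵘ-injective (begin
  toℚᵘ (a ℚ./ suc n ℚ.* ι (+ suc n))             ≈⟨ ℚ.toℚᵘ-homo-* (a ℚ./ suc n) (ι (+ suc n)) ⟩
  toℚᵘ (a ℚ./ suc n) ℚᵘ.* toℚᵘ (ι (+ suc n))     ≈⟨ ℚᵘ.*-cong (ℚ.toℚᵘ-fromℚᵘ (mkℚᵘ a n)) (toℚᵘ-ι (+ suc n)) ⟩
  mkℚᵘ a n ℚᵘ.* mkℚᵘ (+ suc n) 0                 ≈⟨ *≡* (trans (ℤ.*-identityʳ (a * + suc n)) (cong (λ m → a * + suc m) (sym (ℕ.*-identityʳ n)))) ⟩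
  mkℚᵘ a 0                                       ≈⟨ toℚᵘ-ι a ⟨
  toℚᵘ (ι a)                                     ∎)
  where open ℚᵘ.≃-Reasoning
⁄-*-cancel a ℤ.-[1+ n ] = begin
  (- a) ℚ./ suc n ℚ.* ι ℤ.-[1+ n ]            ≡⟨ cong ((- a) ℚ./ suc n ℚ.*_) (ι-neg (+ suc n)) ⟩
  (- a) ℚ./ suc n ℚ.* ℚ.- ι (+ suc n)         ≡⟨ ℚ.neg-distribʳ-* ((- a) ℚ./ suc n) (ι (+ suc n)) ⟨
  ℚ.- ((- a) ℚ./ suc n ℚ.* ι (+ suc n))       ≡⟨ cong ℚ.-_ (⁄-*-cancel (- a) (+ suc n)) ⟩
  ℚ.- ι (- a)                                 ≡⟨ ι-neg (- a) ⟨
  ι (- - a)                                   ≡⟨ cong ι (ℤ.neg-involutive a) ⟩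
  ι a                                         ∎
  where open ≡-Reasoning

*-cancelʳ-≡-pos : ∀ r .{{_ : ℚ.Positive r}} {p q} → p ℚ.* r ≡ q ℚ.* r → p ≡ q
*-cancelʳ-≡-pos r pr≡qr = ℚ.≤-antisym
  (ℚ.*-cancelʳ-≤-pos r (ℚ.≤-reflexive pr≡qr))
  (ℚ.*-cancelʳ-≤-pos r (ℚ.≤-reflexive (sym pr≡qr)))

floor-≤ : ∀ q → ι (floor q) ℚ.≤ q
floor-≤ q@(mkℚ n d _) = ℚ.toℚᵘ-cancel-≤ (begin
  toℚᵘ (ι (floor q))  ≃⟨ toℚᵘ-ι (floor q) ⟩
  mkℚᵘ (floor q) 0    ≤⟨ *≤* (ℤ.≤-trans (ℤ.[n/d]*d≤n n (+ suc d)) (ℤ.≤-reflexive (sym (ℤ.*-identityʳ n)))) ⟩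
  mkℚᵘ n d            ∎)
  where open ℚᵘ.≤-Reasoning

<-suc-floor : ∀ q → q ℚ.< ι (ℤ.suc (floor q))
<-suc-floor q@(mkℚ n d _) = ℚ.toℚᵘ-cancel-< (begin-strict
  mkℚᵘ n d                      <⟨ *<* (ℤ.≤-<-trans (ℤ.≤-reflexive (ℤ.*-identityʳ n)) n<) ⟩
  mkℚᵘ (ℤ.suc (floor q)) 0      ≃⟨ toℚᵘ-ι (ℤ.suc (floor q)) ⟨
  toℚᵘ (ι (ℤ.suc (floor q)))    ∎)
  where
  open ℚᵘ.≤-Reasoning
  n< : n < ℤ.suc (n ℤ./ + suc d) * + suc d
  n< = subst (λ k → n < ℤ.suc k * + suc d) (sym (ℤ.div-pos-is-/ℕ n (suc d))) (ℤ.n<s[n/ℕd]*d n (suc d))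

p≤∣p∣ : ∀ p → p ℚ.≤ ℚ.∣ p ∣
p≤∣p∣ (mkℚ (+ n) d _) = ℚ.≤-refl
p≤∣p∣ p@(mkℚ ℤ.-[1+ n ] d _) = ℚ.≤-trans (ℚ.<⇒≤ (ℚ.negative⁻¹ p)) (ℚ.0≤∣p∣ p)

ι-suc : ∀ k → ι (ℤ.suc k) ≡ ι k ℚ.+ 1ℚ
ι-suc k = trans (ι-+ 1ℤ k) (ℚ.+-comm 1ℚ (ι k))

<-suc⇒≤ : ∀ {i j} → i < ℤ.suc j → i ≤ j
<-suc⇒≤ {i} {j} i<1+j = subst (i ≤_) (ℤ.pred-suc j) (ℤ.i<j⇒i≤pred[j] i<1+j)

-- Both `k` and `floor q` are integers m with m ≤ q < m + 1, and there is only one.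
frac-unique : ∀ k {f q} → 0ℚ ℚ.≤ f → f ℚ.< 1ℚ → q ≡ ι k ℚ.+ f → frac q ≡ f
frac-unique k {f} {q} 0≤f f<1 q≡k+f = begin
  q ℚ.- ι (floor q)        ≡⟨ cong₂ (λ p m → p ℚ.- ι m) q≡k+f floor≡k ⟩
  ι k ℚ.+ f ℚ.- ι k        ≡⟨ solve 2 (λ x y → x :+ y :- x := y) refl (ι k) f ⟩
  f                        ∎
  where
  open ≡-Reasoning
  open ℚ.+-*-Solver
  k≤q : ι k ℚ.≤ q
  k≤q = subst₂ ℚ._≤_ (ℚ.+-identityʳ (ι k)) (sym q≡k+f) (ℚ.+-monoʳ-≤ (ι k) 0≤f)
  q<1+k : q ℚ.< ι (ℤ.suc k)
  q<1+k = subst₂ ℚ._<_ (sym q≡k+f) (sym (ι-suc k)) (ℚ.+-monoʳ-< (ι k) f<1)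
  floor≡k : floor q ≡ k
  floor≡k = ℤ.≤-antisym
    (<-suc⇒≤ (ι-cancel-< (ℚ.≤-<-trans (floor-≤ q) q<1+k)))
    (<-suc⇒≤ (ι-cancel-< (ℚ.≤-<-trans k≤q (<-suc-floor q))))

-- Divisibility writes `e ⁄ d` as an integer plus `r ⁄ d`. This evaluates the fractional parts of
-- the formula: only the residue of the numerator has to be known.
frac-⁄ : ∀ e d r .{{_ : NonZero d}} → 0ℤ < d → 0ℤ ≤ r → r < d → d ∣ e - r → frac (e ⁄ d) ≡ r ⁄ d
frac-⁄ e d r 0<d 0≤r r<d (divides k e-r≡kd) = frac-unique k 0≤r/d r/d<1 (*-cancelʳ-≡-pos (ι d) {e ⁄ d} {ι k ℚ.+ r ⁄ d} e/d)
  where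
  open ≡-Reasoning
  instance
    d⁺ : ℚ.Positive (ι d)
    d⁺ = ι-positive 0<d
  0≤r/d : 0ℚ ℚ.≤ r ⁄ d
  0≤r/d = ℚ.*-cancelʳ-≤-pos (ι d)
    (subst₂ ℚ._≤_ (sym (ℚ.*-zeroˡ (ι d))) (sym (⁄-*-cancel r d)) (ι-mono-≤ 0≤r))
  r/d<1 : r ⁄ d ℚ.< 1ℚ
  r/d<1 = ℚ.*-cancelʳ-<-nonNeg (ι d) {{ℚ.pos⇒nonNeg (ι d)}}
    (subst₂ ℚ._<_ (sym (⁄-*-cancel r d)) (sym (ℚ.*-identityˡ (ι d))) (ι-mono-< r<d))
  shift : ∀ e r → e ≡ (e - r) + r
  shift = solve-∀
  e/d : (e ⁄ d) ℚ.* ι d ≡ (ι k ℚ.+ r ⁄ d) ℚ.* ι d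
  e/d = begin
    (e ⁄ d) ℚ.* ι d                        ≡⟨ ⁄-*-cancel e d ⟩
    ι e                                    ≡⟨ cong ι (trans (shift e r) (cong (_+ r) e-r≡kd)) ⟩
    ι (k * d + r)                          ≡⟨ ι-+ (k * d) r ⟩
    ι (k * d) ℚ.+ ι r                      ≡⟨ cong₂ ℚ._+_ (ι-* k d) (sym (⁄-*-cancel r d)) ⟩
    ι k ℚ.* ι d ℚ.+ (r ⁄ d) ℚ.* ι d        ≡⟨ ℚ.*-distribʳ-+ (ι d) (ι k) (r ⁄ d) ⟨
    (ι k ℚ.+ r ⁄ d) ℚ.* ι d                ∎

-- The integer equation is the conclusion with its denominators cleared. `D` and `E` are cancelled
-- one after the other, as each of the two small fractions contains only one of them.
⁄-formula : ∀ A D E r s t .{{_ : NonZero D}} .{{_ : NonZero E}} .{{_ : NonZero (D * E)}} →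
  0ℤ < D → 0ℤ < E → t * (D * E) ≡ A - r * E - s * D + D * E →
  ι t ≡ A ⁄ (D * E) ℚ.- r ⁄ D ℚ.- s ⁄ E ℚ.+ 1ℚ
⁄-formula A D E r s t 0<D 0<E eq = *-cancelʳ-≡-pos (ι D) (*-cancelʳ-≡-pos (ι E) (begin
  ι t ℚ.* ι D ℚ.* ι E
    ≡⟨ ℚ.*-assoc (ι t) (ι D) (ι E) ⟩
  ι t ℚ.* (ι D ℚ.* ι E)
    ≡⟨ trans (ι-* t (D * E)) (cong (ι t ℚ.*_) (ι-* D E)) ⟨
  ι (t * (D * E))
    ≡⟨ cong ι eq ⟩
  ι (A - r * E - s * D + D * E)
    ≡⟨ trans (ι-+ (A - r * E - s * D) (D * E)) (cong₂ ℚ._+_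
         (trans (ι-- (A - r * E) (s * D)) (cong₂ ℚ._-_
           (trans (ι-- A (r * E)) (cong (λ u → ι A ℚ.- u) (ι-* r E))) (ι-* s D))) (ι-* D E)) ⟩
  ι A ℚ.- ι r ℚ.* ι E ℚ.- ι s ℚ.* ι D ℚ.+ ι D ℚ.* ι E
    ≡⟨ cong₂ (λ u v → u ℚ.- v ℚ.- ι s ℚ.* ι D ℚ.+ ι D ℚ.* ι E)
         (trans (cong (A ⁄ (D * E) ℚ.*_) (sym (ι-* D E))) (⁄-*-cancel A (D * E)))
         (cong (ℚ._* ι E) (⁄-*-cancel r D)) ⟨
  A ⁄ (D * E) ℚ.* (ι D ℚ.* ι E) ℚ.- r ⁄ D ℚ.* ι D ℚ.* ι E ℚ.- ι s ℚ.* ι D ℚ.+ ι D ℚ.* ι E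
    ≡⟨ cong (λ u → A ⁄ (D * E) ℚ.* (ι D ℚ.* ι E) ℚ.- r ⁄ D ℚ.* ι D ℚ.* ι E ℚ.- u ℚ.* ι D ℚ.+ ι D ℚ.* ι E)
         (⁄-*-cancel s E) ⟨
  A ⁄ (D * E) ℚ.* (ι D ℚ.* ι E) ℚ.- r ⁄ D ℚ.* ι D ℚ.* ι E ℚ.- s ⁄ E ℚ.* ι E ℚ.* ι D ℚ.+ ι D ℚ.* ι E
    ≡⟨ solve 5 (λ a b c d e → a :* (d :* e) :- b :* d :* e :- c :* e :* d :+ d :* e
                            := (a :- b :- c :+ con 1ℚ) :* d :* e) refl
         (A ⁄ (D * E)) (r ⁄ D) (s ⁄ E) (ι D) (ι E) ⟩
  (A ⁄ (D * E) ℚ.- r ⁄ D ℚ.- s ⁄ E ℚ.+ 1ℚ) ℚ.* ι D ℚ.* ι E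
    ∎))
  where
  open ≡-Reasoning
  open ℚ.+-*-Solver
  instance
    D⁺ : ℚ.Positive (ι D)
    D⁺ = ι-positive 0<D
    E⁺ : ℚ.Positive (ι E)
    E⁺ = ι-positive 0<E

-- Slopes as determinant signs; integer half planes and closures.

i<j⇒0<j-i : ∀ {i j} → i < j → 0ℤ < j - i
i<j⇒0<j-i {i} {j} i<j = subst (_< j - i) (ℤ.+-inverseʳ i) (ℤ.+-monoˡ-< (- i) i<j)

-- Multiplying by `x₁ * x₂` clears both denominators, and keeps the direction of the inequality also
-- when both entries are negative.
⁄<⁄⇒< : ∀ x₁ y₁ x₂ y₂ .{{_ : NonZero x₁}} .{{_ : NonZero x₂}} →
        0ℤ < x₁ * x₂ → y₁ ⁄ x₁ ℚ.< y₂ ⁄ x₂ → 0ℤ < x₁ * y₂ - x₂ * y₁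
⁄<⁄⇒< x₁ y₁ x₂ y₂ 0<x₁x₂ s<t = i<j⇒0<j-i (ι-cancel-< {x₂ * y₁} {x₁ * y₂}
  (subst₂ ℚ._<_ lhs rhs (ℚ.*-monoˡ-<-pos (ι (x₁ * x₂)) s<t)))
  where
  open ≡-Reasoning
  open ℚ.+-*-Solver
  instance
    x₁x₂⁺ : ℚ.Positive (ι (x₁ * x₂))
    x₁x₂⁺ = ι-positive 0<x₁x₂
  lhs : y₁ ⁄ x₁ ℚ.* ι (x₁ * x₂) ≡ ι (x₂ * y₁)
  lhs = begin
    y₁ ⁄ x₁ ℚ.* ι (x₁ * x₂)         ≡⟨ cong (y₁ ⁄ x₁ ℚ.*_) (ι-* x₁ x₂) ⟩
    y₁ ⁄ x₁ ℚ.* (ι x₁ ℚ.* ι x₂)     ≡⟨ solve 3 (λ s a b → s :* (a :* b) := b :* (s :* a)) refl (y₁ ⁄ x₁) (ι x₁) (ι x₂) ⟩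
    ι x₂ ℚ.* (y₁ ⁄ x₁ ℚ.* ι x₁)     ≡⟨ cong (ι x₂ ℚ.*_) (⁄-*-cancel y₁ x₁) ⟩
    ι x₂ ℚ.* ι y₁                   ≡⟨ ι-* x₂ y₁ ⟨
    ι (x₂ * y₁)                     ∎
  rhs : y₂ ⁄ x₂ ℚ.* ι (x₁ * x₂) ≡ ι (x₁ * y₂)
  rhs = begin
    y₂ ⁄ x₂ ℚ.* ι (x₁ * x₂)         ≡⟨ cong (y₂ ⁄ x₂ ℚ.*_) (ι-* x₁ x₂) ⟩
    y₂ ⁄ x₂ ℚ.* (ι x₁ ℚ.* ι x₂)     ≡⟨ solve 3 (λ s a b → s :* (a :* b) := a :* (s :* b)) refl (y₂ ⁄ x₂) (ι x₁) (ι x₂) ⟩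
    ι x₁ ℚ.* (y₂ ⁄ x₂ ℚ.* ι x₂)     ≡⟨ cong (ι x₁ ℚ.*_) (⁄-*-cancel y₂ x₂) ⟩
    ι x₁ ℚ.* ι y₂                   ≡⟨ ι-* x₁ y₂ ⟨
    ι (x₁ * y₂)                     ∎

-- With ε = 1/(|a| + |b| + 1), an approximation within ε moves the value of
-- the integer a n₁ + b n₂ by less than 1.
closure-halfPlane : ∀ a b {S : Pred (Vec ℚ 2) 0ℓ} →
  (∀ u v → (u ∷ v ∷ []) ∈ S → 0ℚ ℚ.≤ ι a ℚ.* u ℚ.+ ι b ℚ.* v) →
  ∀ n₁ n₂ → map ι (n₁ ∷ n₂ ∷ []) ∈ Closure S → 0ℤ ≤ a * n₁ + b * n₂
closure-halfPlane a b {S} S⊆H n₁ n₂ n∈S̄ = conclude (n∈S̄ ε (ℚ.positive⁻¹ ε))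
  where
  open ℚ.+-*-Solver
  ∣a∣ ∣b∣ K : ℚ
  ∣a∣ = ℚ.∣ ι a ∣
  ∣b∣ = ℚ.∣ ι b ∣
  K   = ∣a∣ ℚ.+ ∣b∣ ℚ.+ 1ℚ
  instance
    ∣a∣≥0 : ℚ.NonNegative ∣a∣
    ∣a∣≥0 = ℚ.∣-∣-nonNeg (ι a)
    ∣b∣≥0 : ℚ.NonNegative ∣b∣
    ∣b∣≥0 = ℚ.∣-∣-nonNeg (ι b)
    K⁺ : ℚ.Positive K
    K⁺ = ℚ.nonNeg+pos⇒pos (∣a∣ ℚ.+ ∣b∣) {{ℚ.nonNeg+nonNeg⇒nonNeg ∣a∣ ∣b∣}} 1ℚ
    K≢0 : ℚ.NonZero K
    K≢0 = ℚ.pos⇒nonZero K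
  ε : ℚ
  ε = ℚ.1/ K
  instance
    ε⁺ : ℚ.Positive ε
    ε⁺ = ℚ.1/pos⇒pos K
  open ℚ.≤-Reasoning

  bound : ∀ c {δ} → ℚ.∣ δ ∣ ℚ.< ε → ι c ℚ.* δ ℚ.≤ ℚ.∣ ι c ∣ ℚ.* ε
  bound c {δ} ∣δ∣<ε = begin
    ι c ℚ.* δ              ≤⟨ p≤∣p∣ (ι c ℚ.* δ) ⟩
    ℚ.∣ ι c ℚ.* δ ∣        ≡⟨ ℚ.∣p*q∣≡∣p∣*∣q∣ (ι c) δ ⟩
    ℚ.∣ ι c ∣ ℚ.* ℚ.∣ δ ∣  ≤⟨ ℚ.*-monoˡ-≤-nonNeg ℚ.∣ ι c ∣ {{ℚ.∣-∣-nonNeg (ι c)}} (ℚ.<⇒≤ ∣δ∣<ε) ⟩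
    ℚ.∣ ι c ∣ ℚ.* ε        ∎

  conclude : (∃ λ w → w ∈ S × Pointwise.Pointwise (λ p q → ℚ.∣ p ℚ.- q ∣ ℚ.< ε) w (map ι (n₁ ∷ n₂ ∷ []))) →
             0ℤ ≤ a * n₁ + b * n₂
  conclude (u ∷ v ∷ [] , u∈S , ∣u-n₁∣<ε Pointwise.∷ ∣v-n₂∣<ε Pointwise.∷ Pointwise.[]) =
    <-suc⇒≤ (ι-cancel-< (begin-strict
      0ℚ
        ≤⟨ S⊆H u v u∈S ⟩
      ι a ℚ.* u ℚ.+ ι b ℚ.* v
        ≡⟨ solve 6 (λ a b u v m n → a :* u :+ b :* v :=
             a :* (u :- m) :+ b :* (v :- n) :+ (a :* m :+ b :* n)) refl (ι a) (ι b) u v (ι n₁) (ι n₂) ⟩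
      ι a ℚ.* (u ℚ.- ι n₁) ℚ.+ ι b ℚ.* (v ℚ.- ι n₂) ℚ.+ (ι a ℚ.* ι n₁ ℚ.+ ι b ℚ.* ι n₂)
        ≤⟨ ℚ.+-monoˡ-≤ (ι a ℚ.* ι n₁ ℚ.+ ι b ℚ.* ι n₂) (ℚ.+-mono-≤ (bound a ∣u-n₁∣<ε) (bound b ∣v-n₂∣<ε)) ⟩
      ∣a∣ ℚ.* ε ℚ.+ ∣b∣ ℚ.* ε ℚ.+ (ι a ℚ.* ι n₁ ℚ.+ ι b ℚ.* ι n₂)
        <⟨ ℚ.+-monoˡ-< (ι a ℚ.* ι n₁ ℚ.+ ι b ℚ.* ι n₂) (subst₂ ℚ._<_ (ℚ.+-identityʳ (∣a∣ ℚ.* ε ℚ.+ ∣b∣ ℚ.* ε)) Kε≡1 (ℚ.+-monoʳ-< (∣a∣ ℚ.* ε ℚ.+ ∣b∣ ℚ.* ε) (ℚ.positive⁻¹ ε))) ⟩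
      1ℚ ℚ.+ (ι a ℚ.* ι n₁ ℚ.+ ι b ℚ.* ι n₂)
        ≡⟨ cong (1ℚ ℚ.+_) (trans (ι-+ (a * n₁) (b * n₂)) (cong₂ ℚ._+_ (ι-* a n₁) (ι-* b n₂))) ⟨
      1ℚ ℚ.+ ι (a * n₁ + b * n₂)
        ≡⟨ ι-+ 1ℤ (a * n₁ + b * n₂) ⟨
      ι (ℤ.suc (a * n₁ + b * n₂))
        ∎))
    where
    Kε≡1 : ∣a∣ ℚ.* ε ℚ.+ ∣b∣ ℚ.* ε ℚ.+ ε ≡ 1ℚ
    Kε≡1 = trans
      (solve 3 (λ a b e → a :* e :+ b :* e :+ e := (a :+ b :+ con 1ℚ) :* e) refl ∣a∣ ∣b∣ ε)
      (ℚ.*-inverseʳ K)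

-- Integer order, division with remainder, Bézout identities, finite bijections.

0≤i*j : ∀ {i j} → 0ℤ ≤ i → 0ℤ ≤ j → 0ℤ ≤ i * j
0≤i*j {i} {j} 0≤i 0≤j = ℤ.*-monoʳ-≤-nonNeg j {{ℤ.nonNegative 0≤j}} 0≤i

0<i*j : ∀ {i j} → 0ℤ < i → 0ℤ < j → 0ℤ < i * j
0<i*j {i} {j} 0<i 0<j = ℤ.*-monoʳ-<-pos j {{ℤ.positive 0<j}} 0<i

0≤i*j⇒0≤i : ∀ {i j} → 0ℤ < j → 0ℤ ≤ i * j → 0ℤ ≤ i
0≤i*j⇒0≤i {i} {j} 0<j = ℤ.*-cancelʳ-≤-pos 0ℤ i j {{ℤ.positive 0<j}}

*-cancelʳ-<-pos : ∀ {i j} k → 0ℤ < k → i * k < j * k → i < j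
*-cancelʳ-<-pos k 0<k = ℤ.*-cancelʳ-<-nonNeg k {{ℤ.nonNegative (ℤ.<⇒≤ 0<k)}}

-- The final implication is there to let the quotient be read as a natural number in `quotient₁₃`.
euclid : ∀ a d → 0ℤ < d → ∃₂ λ k r → 0ℤ ≤ r × r < d × a ≡ r + k * d × (0ℤ ≤ a → 0ℤ ≤ k)
euclid a d 0<d = a ℤ./ d , + (a ℤ.% d) , ℤ.+≤+ ℕ.z≤n ,
  subst (+ (a ℤ.% d) <_) (ℤ.0≤i⇒+∣i∣≡i (ℤ.<⇒≤ 0<d)) (ℤ.+<+ (ℤ.n%d<d a d)) ,
  ℤ.a≡a%n+[a/n]*n a d ,
  λ 0≤a → ℤ.0≤n⇒0≤n/d a d 0≤a (ℤ.<⇒≤ 0<d)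
  where
  instance
    d≢0 : NonZero d
    d≢0 = ℤ.>-nonZero 0<d

±-abs : ∀ i → ∃ λ σ → σ * i ≡ + ℤ.∣ i ∣
±-abs (+ n)       = 1ℤ , ℤ.*-identityˡ (+ n)
±-abs ℤ.-[1+ n ]  = ℤ.-1ℤ , ℤ.-1*i≡-i ℤ.-[1+ n ]

bézout-ℕ : ∀ m n → ∃₂ λ p q → p * + m + q * + n ≡ + ℕ.gcd m n
bézout-ℕ m n with ℕ.Bézout.identity (ℕ.gcd-GCD m n)
... | ℕ.Bézout.+- x y eq = + x , - + y , lemma (+ ℕ.gcd m n) (+ x) (+ y) (+ m) (+ n)
        (trans (cong (λ z → + ℕ.gcd m n + z) (sym (ℤ.pos-* y n))) (trans (cong +_ eq) (ℤ.pos-* x m)))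
  where
  lemma : ∀ d x y m n → d + y * n ≡ x * m → x * m + - y * n ≡ d
  lemma d x y m n eq = trans (cong (_+ - y * n) (sym eq)) (cancel d y n)
    where
    cancel : ∀ d y n → d + y * n + - y * n ≡ d
    cancel = solve-∀
... | ℕ.Bézout.-+ x y eq = - + x , + y , lemma (+ ℕ.gcd m n) (+ x) (+ y) (+ m) (+ n)
        (trans (cong (λ z → + ℕ.gcd m n + z) (sym (ℤ.pos-* x m))) (trans (cong +_ eq) (ℤ.pos-* y n)))
  where
  lemma : ∀ d x y m n → d + x * m ≡ y * n → - x * m + y * n ≡ d
  lemma d x y m n eq = trans (cong (λ z → - x * m + z) (sym eq)) (cancel d x m)
    where
    cancel : ∀ d x m → - x * m + (d + x * m) ≡ d
    cancel = solve-∀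

bézout : ∀ i j → ∃₂ λ p q → p * i + q * j ≡ + ℕ.gcd ℤ.∣ i ∣ ℤ.∣ j ∣
bézout i j with ±-abs i | ±-abs j | bézout-ℕ ℤ.∣ i ∣ ℤ.∣ j ∣
... | σ , σi≡∣i∣ | τ , τj≡∣j∣ | p , q , eq = p * σ , q * τ ,
  trans (cong₂ _+_ (ℤ.*-assoc p σ i) (ℤ.*-assoc q τ j))
    (trans (cong₂ (λ u v → p * u + q * v) σi≡∣i∣ τj≡∣j∣) eq)

-- Zero is neutral for `gcd`, so `OnePrime` yields a Bézout identity in all three minors whether or
-- not some vanish.
foldr-gcd-filter : ∀ ks → List.foldr ℕ.gcd 0 (List.filter (λ k → ¬? (k ℕ.≟ 0)) ks) ≡ List.foldr ℕ.gcd 0 ks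
foldr-gcd-filter List.[] = refl
foldr-gcd-filter (zero List.∷ ks) = trans (foldr-gcd-filter ks) (sym (ℕ.gcd-identityˡ _))
foldr-gcd-filter (suc k List.∷ ks) = cong (ℕ.gcd (suc k)) (foldr-gcd-filter ks)

bézout₃ : ∀ i j k → ℕ.gcd ℤ.∣ i ∣ (ℕ.gcd ℤ.∣ j ∣ (ℕ.gcd ℤ.∣ k ∣ 0)) ≡ 1 →
          ∃ λ p → ∃₂ λ q r → p * i + q * j + r * k ≡ 1ℤ
bézout₃ i j k gcd≡1 with bézout j k
... | q , r , qj+rk≡g with bézout i (+ ℕ.gcd ℤ.∣ j ∣ ℤ.∣ k ∣)
... | p , u , pi+ug≡1 = p , u * q , u * r , (begin
  p * i + u * q * j + u * r * k                         ≡⟨ distribute p i u q j r k ⟩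
  p * i + u * (q * j + r * k)                           ≡⟨ cong (λ w → p * i + u * w) qj+rk≡g ⟩
  p * i + u * + ℕ.gcd ℤ.∣ j ∣ ℤ.∣ k ∣                   ≡⟨ pi+ug≡1 ⟩
  + ℕ.gcd ℤ.∣ i ∣ (ℕ.gcd ℤ.∣ j ∣ ℤ.∣ k ∣)               ≡⟨ cong (λ w → + ℕ.gcd ℤ.∣ i ∣ (ℕ.gcd ℤ.∣ j ∣ w)) (ℕ.gcd-identityʳ ℤ.∣ k ∣) ⟨
  + ℕ.gcd ℤ.∣ i ∣ (ℕ.gcd ℤ.∣ j ∣ (ℕ.gcd ℤ.∣ k ∣ 0))     ≡⟨ cong +_ gcd≡1 ⟩
  1ℤ                                                    ∎)
  where
  open ≡-Reasoning
  distribute : ∀ p i u q j r k → p * i + u * q * j + u * r * k ≡ p * i + u * (q * j + r * k)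
  distribute = solve-∀

-- Since proofs of `P x` are all equal, a pair is determined by its first component, and `surj`
-- already supplies the inverse.
Fin↔Σ : ∀ {A : Set} {P : A → Set} → (∀ {x} (p q : P x) → p ≡ q) →
        ∀ {t} (g : Fin t → A) → (∀ k → P (g k)) → (∀ {k l} → g k ≡ g l → k ≡ l) →
        (∀ x → P x → ∃ λ k → g k ≡ x) → Fin t ↔ Σ A P
Fin↔Σ {A} {P} irr g g∈P inj surj = mk↔ₛ′ to from to∘from (λ k → inj (proj₂ (surj (g k) (g∈P k))))
  where
  to = λ k → g k , g∈P k
  from : Σ A P → _
  from (x , p) = proj₁ (surj x p)
  to∘from : ∀ xp → to (from xp) ≡ xp
  to∘from (x , p) with surj x p
  ... | k , refl = cong (g k ,_) (irr _ _)

-- The integer solutions of `M c = n`.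

module Columns (x₁ x₂ x₃ y₁ y₂ y₃ : ℤ) where

  M : Matrix ℤ 2 3
  M = (x₁ ∷ x₂ ∷ x₃ ∷ []) ∷ (y₁ ∷ y₂ ∷ y₃ ∷ []) ∷ []

  Y₁₂ Y₁₃ Y₂₃ Y₃₂ : ℤ
  Y₁₂ = x₁ * y₂ - x₂ * y₁
  Y₁₃ = x₁ * y₃ - x₃ * y₁
  Y₂₃ = x₂ * y₃ - x₃ * y₂
  Y₃₂ = x₃ * y₂ - x₂ * y₃

  -- The nested sums ending in `0ℤ` are what `*ᵥ` unfolds to, so solutions over ℕ convert without
  -- rewriting. Keeping two scalar equations allows matching on `refl`, which leaves pure polynomial
  -- identities.
  record Combination (n₁ n₂ c₁ c₂ c₃ : ℤ) : Set where
    constructor combination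
    field
      fst : x₁ * c₁ + (x₂ * c₂ + (x₃ * c₃ + 0ℤ)) ≡ n₁
      snd : y₁ * c₁ + (y₂ * c₂ + (y₃ * c₃ + 0ℤ)) ≡ n₂

  module _ {n₁ n₂ c₁ c₂ c₃ : ℤ} where

    -- Cramer's rule: the determinant is alternating, so pairing `n` with a column removes that
    -- column's coefficient. The order of the factors makes `det₁` and `det₂` nonnegative on the
    -- first sector and `det₃` nonnegative on the second, where `det₂` changes sign.
    det₁ : Combination n₁ n₂ c₁ c₂ c₃ → n₂ * x₁ - n₁ * y₁ ≡ c₂ * Y₁₂ + c₃ * Y₁₃
    det₁ (combination refl refl) = identity x₁ x₂ x₃ y₁ y₂ y₃ c₁ c₂ c₃
      where
      identity : ∀ x₁ x₂ x₃ y₁ y₂ y₃ c₁ c₂ c₃ →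
        (y₁ * c₁ + (y₂ * c₂ + (y₃ * c₃ + 0ℤ))) * x₁ - (x₁ * c₁ + (x₂ * c₂ + (x₃ * c₃ + 0ℤ))) * y₁
          ≡ c₂ * (x₁ * y₂ - x₂ * y₁) + c₃ * (x₁ * y₃ - x₃ * y₁)
      identity = solve-∀

    det₂ : Combination n₁ n₂ c₁ c₂ c₃ → n₁ * y₂ - n₂ * x₂ ≡ c₁ * Y₁₂ - c₃ * Y₂₃
    det₂ (combination refl refl) = identity x₁ x₂ x₃ y₁ y₂ y₃ c₁ c₂ c₃
      where
      identity : ∀ x₁ x₂ x₃ y₁ y₂ y₃ c₁ c₂ c₃ →
        (x₁ * c₁ + (x₂ * c₂ + (x₃ * c₃ + 0ℤ))) * y₂ - (y₁ * c₁ + (y₂ * c₂ + (y₃ * c₃ + 0ℤ))) * x₂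
          ≡ c₁ * (x₁ * y₂ - x₂ * y₁) - c₃ * (x₂ * y₃ - x₃ * y₂)
      identity = solve-∀

    det₃ : Combination n₁ n₂ c₁ c₂ c₃ → n₁ * y₃ - n₂ * x₃ ≡ c₁ * Y₁₃ + c₂ * Y₂₃
    det₃ (combination refl refl) = identity x₁ x₂ x₃ y₁ y₂ y₃ c₁ c₂ c₃
      where
      identity : ∀ x₁ x₂ x₃ y₁ y₂ y₃ c₁ c₂ c₃ →
        (x₁ * c₁ + (x₂ * c₂ + (x₃ * c₃ + 0ℤ))) * y₃ - (y₁ * c₁ + (y₂ * c₂ + (y₃ * c₃ + 0ℤ))) * x₃
          ≡ c₁ * (x₁ * y₃ - x₃ * y₁) + c₂ * (x₂ * y₃ - x₃ * y₂)
      identity = solve-∀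

    -- The vector (`Y₂₃`, `- Y₁₃`, `Y₁₂`) is the cross product of the two rows of `M`, hence
    -- orthogonal to both.
    translate : ∀ k → Combination n₁ n₂ c₁ c₂ c₃ →
                Combination n₁ n₂ (c₁ + k * Y₂₃) (c₂ - k * Y₁₃) (c₃ + k * Y₁₂)
    translate k (combination eq₁ eq₂) = combination
      (trans (identity₁ x₁ x₂ x₃ y₁ y₂ y₃ c₁ c₂ c₃ k) eq₁)
      (trans (identity₂ x₁ x₂ x₃ y₁ y₂ y₃ c₁ c₂ c₃ k) eq₂)
      where
      identity₁ : ∀ x₁ x₂ x₃ y₁ y₂ y₃ c₁ c₂ c₃ k →
        x₁ * (c₁ + k * (x₂ * y₃ - x₃ * y₂)) + (x₂ * (c₂ - k * (x₁ * y₃ - x₃ * y₁)) + (x₃ * (c₃ + k * (x₁ * y₂ - x₂ * y₁)) + 0ℤ))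
          ≡ x₁ * c₁ + (x₂ * c₂ + (x₃ * c₃ + 0ℤ))
      identity₁ = solve-∀
      identity₂ : ∀ x₁ x₂ x₃ y₁ y₂ y₃ c₁ c₂ c₃ k →
        y₁ * (c₁ + k * (x₂ * y₃ - x₃ * y₂)) + (y₂ * (c₂ - k * (x₁ * y₃ - x₃ * y₁)) + (y₃ * (c₃ + k * (x₁ * y₂ - x₂ * y₁)) + 0ℤ))
          ≡ y₁ * c₁ + (y₂ * c₂ + (y₃ * c₃ + 0ℤ))
      identity₂ = solve-∀

  module Unimodular (p q r : ℤ) (pY₁₂+qY₁₃+rY₂₃≡1 : p * Y₁₂ + q * Y₁₃ + r * Y₂₃ ≡ 1ℤ) where

    -- Cramer's rule for each pair of columns, weighted by the coefficients p, q, r.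
    ∃-combination : ∀ n₁ n₂ → ∃ λ c₁ → ∃₂ λ c₂ c₃ → Combination n₁ n₂ c₁ c₂ c₃
    ∃-combination n₁ n₂ = _ , _ , _ , combination
      (trans (identity₁ x₁ x₂ x₃ y₁ y₂ y₃ p q r n₁ n₂) (trans (cong (_* n₁) pY₁₂+qY₁₃+rY₂₃≡1) (ℤ.*-identityˡ n₁)))
      (trans (identity₂ x₁ x₂ x₃ y₁ y₂ y₃ p q r n₁ n₂) (trans (cong (_* n₂) pY₁₂+qY₁₃+rY₂₃≡1) (ℤ.*-identityˡ n₂)))
      where
      identity₁ : ∀ x₁ x₂ x₃ y₁ y₂ y₃ p q r n₁ n₂ →
        x₁ * (p * (n₁ * y₂ - x₂ * n₂) + q * (n₁ * y₃ - x₃ * n₂)) +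
        (x₂ * (p * (x₁ * n₂ - n₁ * y₁) + r * (n₁ * y₃ - x₃ * n₂)) +
        (x₃ * (q * (x₁ * n₂ - n₁ * y₁) + r * (x₂ * n₂ - n₁ * y₂)) + 0ℤ))
          ≡ (p * (x₁ * y₂ - x₂ * y₁) + q * (x₁ * y₃ - x₃ * y₁) + r * (x₂ * y₃ - x₃ * y₂)) * n₁
      identity₁ = solve-∀
      identity₂ : ∀ x₁ x₂ x₃ y₁ y₂ y₃ p q r n₁ n₂ →
        y₁ * (p * (n₁ * y₂ - x₂ * n₂) + q * (n₁ * y₃ - x₃ * n₂)) +
        (y₂ * (p * (x₁ * n₂ - n₁ * y₁) + r * (n₁ * y₃ - x₃ * n₂)) +
        (y₃ * (q * (x₁ * n₂ - n₁ * y₁) + r * (x₂ * n₂ - n₁ * y₂)) + 0ℤ))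
          ≡ (p * (x₁ * y₂ - x₂ * y₁) + q * (x₁ * y₃ - x₃ * y₁) + r * (x₂ * y₃ - x₃ * y₂)) * n₂
      identity₂ = solve-∀

    -- The parameter is the value of a linear form that equals 1 on (`Y₂₃`, `- Y₁₃`, `Y₁₂`) by the
    -- Bézout identity. Multiplying each coordinate by that 1 produces mixed products, which the
    -- vanishing determinants, such as `d₁ * Y₁₂ - d₃ * Y₂₃ = 0`, turn into multiples of a single
    -- minor.
    kernel : ∀ {d₁ d₂ d₃} → Combination 0ℤ 0ℤ d₁ d₂ d₃ →
             ∃ λ k → d₁ ≡ k * Y₂₃ × d₂ ≡ - (k * Y₁₃) × d₃ ≡ k * Y₁₂
    kernel {d₁} {d₂} {d₃} comb = p * d₃ - q * d₂ + r * d₁ ,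
      scale d₁ (begin
        d₁ * (p * Y₁₂ + q * Y₁₃ + r * Y₂₃)
          ≡⟨ identity₁ d₁ p q r Y₁₂ Y₁₃ Y₂₃ d₂ d₃ ⟩
        (p * d₃ - q * d₂ + r * d₁) * Y₂₃ + p * (d₁ * Y₁₂ - d₃ * Y₂₃) + q * (d₁ * Y₁₃ + d₂ * Y₂₃)
          ≡⟨ cong₂ (λ u v → (p * d₃ - q * d₂ + r * d₁) * Y₂₃ + p * u + q * v) (det₂ comb) (det₃ comb) ⟨
        (p * d₃ - q * d₂ + r * d₁) * Y₂₃ + p * (0ℤ * y₂ - 0ℤ * x₂) + q * (0ℤ * y₃ - 0ℤ * x₃)
          ≡⟨ vanish ((p * d₃ - q * d₂ + r * d₁) * Y₂₃) p q x₂ y₂ x₃ y₃ ⟩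
        (p * d₃ - q * d₂ + r * d₁) * Y₂₃ ∎) ,
      scale d₂ (begin
        d₂ * (p * Y₁₂ + q * Y₁₃ + r * Y₂₃)
          ≡⟨ identity₂ d₁ p q r Y₁₂ Y₁₃ Y₂₃ d₂ d₃ ⟩
        - ((p * d₃ - q * d₂ + r * d₁) * Y₁₃) + p * (d₂ * Y₁₂ + d₃ * Y₁₃) + r * (d₁ * Y₁₃ + d₂ * Y₂₃)
          ≡⟨ cong₂ (λ u v → - ((p * d₃ - q * d₂ + r * d₁) * Y₁₃) + p * u + r * v) (det₁ comb) (det₃ comb) ⟨
        - ((p * d₃ - q * d₂ + r * d₁) * Y₁₃) + p * (0ℤ * x₁ - 0ℤ * y₁) + r * (0ℤ * y₃ - 0ℤ * x₃)
          ≡⟨ vanish (- ((p * d₃ - q * d₂ + r * d₁) * Y₁₃)) p r y₁ x₁ x₃ y₃ ⟩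
        - ((p * d₃ - q * d₂ + r * d₁) * Y₁₃) ∎) ,
      scale d₃ (begin
        d₃ * (p * Y₁₂ + q * Y₁₃ + r * Y₂₃)
          ≡⟨ identity₃ d₁ p q r Y₁₂ Y₁₃ Y₂₃ d₂ d₃ ⟩
        (p * d₃ - q * d₂ + r * d₁) * Y₁₂ + q * (d₂ * Y₁₂ + d₃ * Y₁₃) + - r * (d₁ * Y₁₂ - d₃ * Y₂₃)
          ≡⟨ cong₂ (λ u v → (p * d₃ - q * d₂ + r * d₁) * Y₁₂ + q * u + - r * v) (det₁ comb) (det₂ comb) ⟨
        (p * d₃ - q * d₂ + r * d₁) * Y₁₂ + q * (0ℤ * x₁ - 0ℤ * y₁) + - r * (0ℤ * y₂ - 0ℤ * x₂)
          ≡⟨ vanish ((p * d₃ - q * d₂ + r * d₁) * Y₁₂) q (- r) y₁ x₁ x₂ y₂ ⟩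
        (p * d₃ - q * d₂ + r * d₁) * Y₁₂ ∎)
      where
      open ≡-Reasoning
      scale : ∀ d {e} → d * (p * Y₁₂ + q * Y₁₃ + r * Y₂₃) ≡ e → d ≡ e
      scale d eq = trans (sym (trans (cong (d *_) pY₁₂+qY₁₃+rY₂₃≡1) (ℤ.*-identityʳ d))) eq
      vanish : ∀ a b c x y x′ y′ → a + b * (0ℤ * y - 0ℤ * x) + c * (0ℤ * y′ - 0ℤ * x′) ≡ a
      vanish = solve-∀
      identity₁ : ∀ d₁ p q r Y₁₂ Y₁₃ Y₂₃ d₂ d₃ → d₁ * (p * Y₁₂ + q * Y₁₃ + r * Y₂₃) ≡
        (p * d₃ - q * d₂ + r * d₁) * Y₂₃ + p * (d₁ * Y₁₂ - d₃ * Y₂₃) + q * (d₁ * Y₁₃ + d₂ * Y₂₃)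
      identity₁ = solve-∀
      identity₂ : ∀ d₁ p q r Y₁₂ Y₁₃ Y₂₃ d₂ d₃ → d₂ * (p * Y₁₂ + q * Y₁₃ + r * Y₂₃) ≡
        - ((p * d₃ - q * d₂ + r * d₁) * Y₁₃) + p * (d₂ * Y₁₂ + d₃ * Y₁₃) + r * (d₁ * Y₁₃ + d₂ * Y₂₃)
      identity₂ = solve-∀
      identity₃ : ∀ d₁ p q r Y₁₂ Y₁₃ Y₂₃ d₂ d₃ → d₃ * (p * Y₁₂ + q * Y₁₃ + r * Y₂₃) ≡
        (p * d₃ - q * d₂ + r * d₁) * Y₁₂ + q * (d₂ * Y₁₂ + d₃ * Y₁₃) + - r * (d₁ * Y₁₂ - d₃ * Y₂₃)
      identity₃ = solve-∀

    difference : ∀ {n₁ n₂ c₁ c₂ c₃ e₁ e₂ e₃} → Combination n₁ n₂ c₁ c₂ c₃ → Combination n₁ n₂ e₁ e₂ e₃ →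
                 ∃ λ k → e₁ ≡ c₁ + k * Y₂₃ × e₂ ≡ c₂ - k * Y₁₃ × e₃ ≡ c₃ + k * Y₁₂
    difference {n₁} {n₂} {c₁} {c₂} {c₃} {e₁} {e₂} {e₃} (combination c-fst c-snd) (combination e-fst e-snd) =
      let k , eq₁ , eq₂ , eq₃ = kernel (combination
            (trans (linear x₁ x₂ x₃ c₁ c₂ c₃ e₁ e₂ e₃) (ℤ.i≡j⇒i-j≡0 (trans e-fst (sym c-fst))))
            (trans (linear y₁ y₂ y₃ c₁ c₂ c₃ e₁ e₂ e₃) (ℤ.i≡j⇒i-j≡0 (trans e-snd (sym c-snd)))))
      in k , trans (shift c₁ e₁) (cong (λ z → c₁ + z) eq₁) , trans (shift c₂ e₂) (cong (λ z → c₂ + z) eq₂) ,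
         trans (shift c₃ e₃) (cong (λ z → c₃ + z) eq₃)
      where
      linear : ∀ x₁ x₂ x₃ c₁ c₂ c₃ e₁ e₂ e₃ →
        x₁ * (e₁ - c₁) + (x₂ * (e₂ - c₂) + (x₃ * (e₃ - c₃) + 0ℤ)) ≡
        (x₁ * e₁ + (x₂ * e₂ + (x₃ * e₃ + 0ℤ))) - (x₁ * c₁ + (x₂ * c₂ + (x₃ * c₃ + 0ℤ)))
      linear = solve-∀
      shift : ∀ c e → e ≡ c + (e - c)
      shift = solve-∀

    -- Counting the nonnegative points on the solution line.

    module Counting (0<Y₁₂ : 0ℤ < Y₁₂) (0<Y₁₃ : 0ℤ < Y₁₃) (0<Y₂₃ : 0ℤ < Y₂₃) where

      -- Dividing `c₂ + Y₁₃` instead of `c₂` gives t = ⌊c₂ / Y₁₃⌋ + 1, the number of admissible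
      -- parameters counted from 0. For `c₂` between `- Y₁₃` and -1 this is 0.
      module _ {n₁ n₂ c₁ c₂ c₃ s : ℤ} {t : ℕ} (comb : Combination n₁ n₂ c₁ c₂ c₃)
               (0≤c₁ : 0ℤ ≤ c₁) (0≤c₃ : 0ℤ ≤ c₃) (0≤s : 0ℤ ≤ s) (s<Y₁₃ : s < Y₁₃)
               (c₂+Y₁₃≡s+tY₁₃ : c₂ + Y₁₃ ≡ s + + t * Y₁₃) where

        private
          n : Vec ℤ 2
          n = n₁ ∷ n₂ ∷ []

        -- Absolute values make this a total function. For parameters from 0 to t - 1 all three
        -- coordinates are nonnegative, and there they change nothing.
        point : ℤ → Vec ℕ 3
        point k = ℤ.∣ c₁ + k * Y₂₃ ∣ ∷ ℤ.∣ c₂ - k * Y₁₃ ∣ ∷ ℤ.∣ c₃ + k * Y₁₂ ∣ ∷ []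

        nonNeg₁ : ∀ k → 0ℤ ≤ c₁ + + k * Y₂₃
        nonNeg₁ k = ℤ.+-mono-≤ 0≤c₁ (0≤i*j {+ k} (ℤ.+≤+ ℕ.z≤n) (ℤ.<⇒≤ 0<Y₂₃))

        nonNeg₃ : ∀ k → 0ℤ ≤ c₃ + + k * Y₁₂
        nonNeg₃ k = ℤ.+-mono-≤ 0≤c₃ (0≤i*j {+ k} (ℤ.+≤+ ℕ.z≤n) (ℤ.<⇒≤ 0<Y₁₂))

        -- Removing one `Y₁₃` from the division equation leaves c₂ - k Y₁₃ = s + (t - 1 - k) Y₁₃.
        nonNeg₂ : ∀ {k} → k ℕ.< t → 0ℤ ≤ c₂ - + k * Y₁₃
        nonNeg₂ {k} k<t = subst (0ℤ ≤_) (sym eq)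
          (ℤ.+-mono-≤ 0≤s (0≤i*j {+ t - + suc k} (ℤ.i≤j⇒0≤j-i (ℤ.+≤+ k<t)) (ℤ.<⇒≤ 0<Y₁₃)))
          where
          open ≡-Reasoning
          isolate : ∀ c d k → c - k * d ≡ (c + d) - (1ℤ + k) * d
          isolate = solve-∀
          collect : ∀ s t d k → s + t * d - k * d ≡ s + (t - k) * d
          collect = solve-∀
          eq : c₂ - + k * Y₁₃ ≡ s + (+ t - + suc k) * Y₁₃
          eq = begin
            c₂ - + k * Y₁₃                   ≡⟨ isolate c₂ Y₁₃ (+ k) ⟩
            (c₂ + Y₁₃) - + suc k * Y₁₃       ≡⟨ cong (_- + suc k * Y₁₃) c₂+Y₁₃≡s+tY₁₃ ⟩
            s + + t * Y₁₃ - + suc k * Y₁₃    ≡⟨ collect s (+ t) Y₁₃ (+ suc k) ⟩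
            s + (+ t - + suc k) * Y₁₃        ∎

        combination⇒solution : ∀ {a b c} → 0ℤ ≤ a → 0ℤ ≤ b → 0ℤ ≤ c → Combination n₁ n₂ a b c →
          M ℤᴹ.*ᵥ map +_ (ℤ.∣ a ∣ ∷ ℤ.∣ b ∣ ∷ ℤ.∣ c ∣ ∷ []) ≡ n
        -- Matching on the inequalities forces the three integers into the form `+ _`, where the
        -- absolute values compute away.
        combination⇒solution (ℤ.+≤+ _) (ℤ.+≤+ _) (ℤ.+≤+ _) (combination eq₁ eq₂) =
          cong₂ (λ u v → u ∷ v ∷ []) eq₁ eq₂

        solution⇒combination : ∀ {a b c} → M ℤᴹ.*ᵥ map +_ (a ∷ b ∷ c ∷ []) ≡ n →
                               Combination n₁ n₂ (+ a) (+ b) (+ c)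
        solution⇒combination eq = combination (cong Vec.head eq) (cong (Vec.head ∘ Vec.tail) eq)

        point-solves : ∀ (k : Fin t) → M ℤᴹ.*ᵥ map +_ (point (+ toℕ k)) ≡ n
        point-solves k = combination⇒solution (nonNeg₁ (toℕ k)) (nonNeg₂ (Fin.toℕ<n k)) (nonNeg₃ (toℕ k))
          (translate (+ toℕ k) comb)

        -- The first coordinate already separates parameters, as it grows in steps of `Y₂₃`.
        point-injective : ∀ {k l} → point (+ k) ≡ point (+ l) → k ≡ l
        point-injective {k} {l} eq = ℤ.+-injective (ℤ.*-cancelʳ-≡ (+ k) (+ l) Y₂₃ {{ℤ.>-nonZero 0<Y₂₃}}
          (∙-cancelˡ c₁ (+ k * Y₂₃) (+ l * Y₂₃) (begin
            c₁ + + k * Y₂₃           ≡⟨ ℤ.0≤i⇒+∣i∣≡i (nonNeg₁ k) ⟨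
            + ℤ.∣ c₁ + + k * Y₂₃ ∣   ≡⟨ cong (+_ ∘ Vec.head) eq ⟩
            + ℤ.∣ c₁ + + l * Y₂₃ ∣   ≡⟨ ℤ.0≤i⇒+∣i∣≡i (nonNeg₁ l) ⟩
            c₁ + + l * Y₂₃           ∎)))
          where open ≡-Reasoning

        -- As `c < d`, the product (k + 1) d exceeds c + k d, so k + 1 is positive.
        0≤parameter : ∀ {c d} k → 0ℤ < d → c < d → 0ℤ ≤ c + k * d → 0ℤ ≤ k
        0≤parameter {c} {d} k 0<d c<d 0≤c+kd = <-suc⇒≤ (*-cancelʳ-<-pos {0ℤ} d 0<d
          (subst (0ℤ <_) (sym (ℤ.suc-* k d)) (ℤ.≤-<-trans 0≤c+kd (ℤ.+-monoˡ-< (k * d) c<d))))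

        -- The gap between k Y₁₃ and t Y₁₃ is (c₂ - k Y₁₃) + (Y₁₃ - s), a nonnegative plus a
        -- positive number.
        parameter<t : ∀ k → 0ℤ ≤ c₂ - k * Y₁₃ → k < + t
        parameter<t k 0≤c₂-kY₁₃ = *-cancelʳ-<-pos Y₁₃ 0<Y₁₃ (begin-strict
          k * Y₁₃                                        ≡⟨ ℤ.+-identityʳ (k * Y₁₃) ⟨
          k * Y₁₃ + 0ℤ                                   <⟨ ℤ.+-monoʳ-< (k * Y₁₃) (ℤ.+-mono-≤-< 0≤c₂-kY₁₃ (i<j⇒0<j-i s<Y₁₃)) ⟩
          k * Y₁₃ + ((c₂ - k * Y₁₃) + (Y₁₃ - s))         ≡⟨ isolate c₂ Y₁₃ k s ⟩
          (c₂ + Y₁₃) - s                                 ≡⟨ cong (_- s) c₂+Y₁₃≡s+tY₁₃ ⟩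
          (s + + t * Y₁₃) - s                            ≡⟨ cancel s (+ t * Y₁₃) ⟩
          + t * Y₁₃                                      ∎)
          where
          open ℤ.≤-Reasoning
          isolate : ∀ c d k s → k * d + ((c - k * d) + (d - s)) ≡ (c + d) - s
          isolate = solve-∀
          cancel : ∀ s u → (s + u) - s ≡ u
          cancel = solve-∀

        -- A coordinate smaller than its own step would become negative at a negative parameter.
        -- Either outer coordinate can play this part, so both sectors share the count.
        count : c₁ < Y₂₃ ⊎ c₃ < Y₁₂ → PartitionCount M n t
        count small = Fin↔Σ (Decidable⇒UIP.≡-irrelevant (Vec.≡-dec ℤ._≟_)) (λ k → point (+ toℕ k)) point-solves
          (Fin.toℕ-injective ∘ point-injective) point-surjective
          where
          0≤k : ∀ {a c} k → + a ≡ c₁ + k * Y₂₃ → + c ≡ c₃ + k * Y₁₂ → 0ℤ ≤ k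
          0≤k k eq₁ eq₃ = case small
            where
            case : c₁ < Y₂₃ ⊎ c₃ < Y₁₂ → 0ℤ ≤ k
            case (inj₁ c₁<Y₂₃) = 0≤parameter k 0<Y₂₃ c₁<Y₂₃ (subst (0ℤ ≤_) eq₁ (ℤ.+≤+ ℕ.z≤n))
            case (inj₂ c₃<Y₁₂) = 0≤parameter k 0<Y₁₂ c₃<Y₁₂ (subst (0ℤ ≤_) eq₃ (ℤ.+≤+ ℕ.z≤n))

          parameterise : ∀ {a b c} k → 0ℤ ≤ k → k < + t →
            + a ≡ c₁ + k * Y₂₃ → + b ≡ c₂ - k * Y₁₃ → + c ≡ c₃ + k * Y₁₂ →
            ∃ λ (k : Fin t) → point (+ toℕ k) ≡ a ∷ b ∷ c ∷ []
          parameterise (+ k) _ (ℤ.+<+ k<t) eq₁ eq₂ eq₃ = fromℕ< k<t , trans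
            (cong (point ∘ +_) (Fin.toℕ-fromℕ< k<t))
            (sym (cong₂ _∷_ (cong ℤ.∣_∣ eq₁) (cong₂ _∷_ (cong ℤ.∣_∣ eq₂) (cong (_∷ []) (cong ℤ.∣_∣ eq₃)))))

          point-surjective : ∀ x → M ℤᴹ.*ᵥ map +_ x ≡ n → ∃ λ (k : Fin t) → point (+ toℕ k) ≡ x
          point-surjective (a ∷ b ∷ c ∷ []) eq =
            let k , eq₁ , eq₂ , eq₃ = difference comb (solution⇒combination eq)
            in parameterise k (0≤k k eq₁ eq₃) (parameter<t k (subst (0ℤ ≤_) eq₂ (ℤ.+≤+ ℕ.z≤n))) eq₁ eq₂ eq₃

      quotient₁₃ : ∀ c₂ → 0ℤ ≤ c₂ + Y₁₃ → ∃₂ λ s t → 0ℤ ≤ s × s < Y₁₃ × c₂ + Y₁₃ ≡ s + + t * Y₁₃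
      quotient₁₃ c₂ 0≤c₂+Y₁₃ with euclid (c₂ + Y₁₃) Y₁₃ 0<Y₁₃
      ... | k , s , 0≤s , s<Y₁₃ , eq , 0≤k = s , ℤ.∣ k ∣ , 0≤s , s<Y₁₃ ,
        trans eq (cong (λ u → s + u * Y₁₃) (sym (ℤ.0≤i⇒+∣i∣≡i (0≤k 0≤c₂+Y₁₃))))

      -- `Reduced` is what distinguishes the sectors: it bounds the coordinate that becomes the
      -- first fractional part of the formula.
      record Count (Reduced : (c₁ c₃ : ℤ) → Set) (n₁ n₂ : ℤ) : Set where
        field
          {c₁ c₂ c₃ s} : ℤ
          t : ℕ
          comb : Combination n₁ n₂ c₁ c₂ c₃
          reduced : Reduced c₁ c₃
          0≤s : 0ℤ ≤ s
          s<Y₁₃ : s < Y₁₃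
          c₂+Y₁₃≡s+tY₁₃ : c₂ + Y₁₃ ≡ s + + t * Y₁₃
          counts : PartitionCount M (n₁ ∷ n₂ ∷ []) t

      Count₁ Count₂ : (n₁ n₂ : ℤ) → Set
      Count₁ = Count λ _ c₃ → 0ℤ ≤ c₃ × c₃ < Y₁₂
      Count₂ = Count λ c₁ _ → 0ℤ ≤ c₁ × c₁ < Y₂₃

      -- Adding the nonnegative (d - c) Y₁₃ to `L` completes it to (c₂ + Y₁₃) d. Nonnegativity of
      -- `c₂` itself cannot be expected: `n` may have no representation at all.
      0≤c₂+Y₁₃ : ∀ {c d L} c₂ → 0ℤ < d → c < d → 0ℤ ≤ L → L ≡ c₂ * d + c * Y₁₃ → 0ℤ ≤ c₂ + Y₁₃
      0≤c₂+Y₁₃ {c} {d} {L} c₂ 0<d c<d 0≤L eq = 0≤i*j⇒0≤i 0<d (subst (0ℤ ≤_) (regroup c c₂ d Y₁₃)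
        (ℤ.+-mono-≤ (subst (0ℤ ≤_) eq 0≤L) (0≤i*j (ℤ.i≤j⇒0≤j-i (ℤ.<⇒≤ c<d)) (ℤ.<⇒≤ 0<Y₁₃))))
        where
        regroup : ∀ c c₂ d e → c₂ * d + c * e + (d - c) * e ≡ (c₂ + e) * d
        regroup = solve-∀

      reduce : ∀ {c d r} k → c ≡ r + k * d → c + - k * d ≡ r
      reduce {c} {d} {r} k eq = trans (cong (_+ - k * d) eq) (cancel r k d)
        where
        cancel : ∀ r k d → r + k * d + - k * d ≡ r
        cancel = solve-∀

      module _ {n₁ n₂ : ℤ} where

        reduce₁ : ∀ {b₁ b₂ b₃} → Combination n₁ n₂ b₁ b₂ b₃ →
                  ∃ λ c₁ → ∃₂ λ c₂ c₃ → Combination n₁ n₂ c₁ c₂ c₃ × 0ℤ ≤ c₁ × c₁ < Y₂₃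
        reduce₁ {b₁} {b₂} {b₃} comb =
          let k , c₁ , 0≤c₁ , c₁<Y₂₃ , b₁≡c₁+kY₂₃ , _ = euclid b₁ Y₂₃ 0<Y₂₃
          in c₁ , b₂ - - k * Y₁₃ , b₃ + - k * Y₁₂ ,
             subst (λ c → Combination n₁ n₂ c (b₂ - - k * Y₁₃) (b₃ + - k * Y₁₂))
               (reduce k b₁≡c₁+kY₂₃) (translate (- k) comb) ,
             0≤c₁ , c₁<Y₂₃

        reduce₃ : ∀ {b₁ b₂ b₃} → Combination n₁ n₂ b₁ b₂ b₃ →
                  ∃ λ c₁ → ∃₂ λ c₂ c₃ → Combination n₁ n₂ c₁ c₂ c₃ × 0ℤ ≤ c₃ × c₃ < Y₁₂
        reduce₃ {b₁} {b₂} {b₃} comb =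
          let k , c₃ , 0≤c₃ , c₃<Y₁₂ , b₃≡c₃+kY₁₂ , _ = euclid b₃ Y₁₂ 0<Y₁₂
          in b₁ + - k * Y₂₃ , b₂ - - k * Y₁₃ , c₃ ,
             subst (Combination n₁ n₂ (b₁ + - k * Y₂₃) (b₂ - - k * Y₁₃))
               (reduce k b₃≡c₃+kY₁₂) (translate (- k) comb) ,
             0≤c₃ , c₃<Y₁₂

        count-reduced₃ : ∀ {c₁ c₂ c₃} → Combination n₁ n₂ c₁ c₂ c₃ → 0ℤ ≤ c₃ → c₃ < Y₁₂ →
          0ℤ ≤ n₂ * x₁ - n₁ * y₁ → 0ℤ ≤ n₁ * y₂ - n₂ * x₂ → Count₁ n₁ n₂
        count-reduced₃ {c₁} {c₂} {c₃} comb 0≤c₃ c₃<Y₁₂ 0≤L₁ 0≤L₂ =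
          let s , t , 0≤s , s<Y₁₃ , eq = quotient₁₃ c₂ (0≤c₂+Y₁₃ c₂ 0<Y₁₂ c₃<Y₁₂ 0≤L₁ (det₁ comb))
          in record
            { t = t ; comb = comb ; reduced = 0≤c₃ , c₃<Y₁₂ ; 0≤s = 0≤s ; s<Y₁₃ = s<Y₁₃
            ; c₂+Y₁₃≡s+tY₁₃ = eq
            ; counts = count comb 0≤c₁ 0≤c₃ 0≤s s<Y₁₃ eq (inj₂ c₃<Y₁₂)
            }
          where
          add : ∀ u v → u - v + v ≡ u
          add = solve-∀
          -- By `det₂`, c₁ Y₁₂ is the determinant with the second column plus c₃ Y₂₃, both
          -- nonnegative on this side of the column.
          0≤c₁ : 0ℤ ≤ c₁
          0≤c₁ = 0≤i*j⇒0≤i 0<Y₁₂ (subst (0ℤ ≤_) (add (c₁ * Y₁₂) (c₃ * Y₂₃))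
            (ℤ.+-mono-≤ (subst (0ℤ ≤_) (det₂ comb) 0≤L₂) (0≤i*j 0≤c₃ (ℤ.<⇒≤ 0<Y₂₃))))

        count-reduced₁ : ∀ {c₁ c₂ c₃} → Combination n₁ n₂ c₁ c₂ c₃ → 0ℤ ≤ c₁ → c₁ < Y₂₃ →
          0ℤ ≤ n₁ * y₃ - n₂ * x₃ → 0ℤ ≤ n₂ * x₂ - n₁ * y₂ → Count₂ n₁ n₂
        count-reduced₁ {c₁} {c₂} {c₃} comb 0≤c₁ c₁<Y₂₃ 0≤L₃ 0≤L₂ =
          let s , t , 0≤s , s<Y₁₃ , eq = quotient₁₃ c₂ (0≤c₂+Y₁₃ c₂ 0<Y₂₃ c₁<Y₂₃ 0≤L₃
                (trans (det₃ comb) (ℤ.+-comm (c₁ * Y₁₃) (c₂ * Y₂₃))))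
          in record
            { t = t ; comb = comb ; reduced = 0≤c₁ , c₁<Y₂₃ ; 0≤s = 0≤s ; s<Y₁₃ = s<Y₁₃
            ; c₂+Y₁₃≡s+tY₁₃ = eq
            ; counts = count comb 0≤c₁ 0≤c₃ 0≤s s<Y₁₃ eq (inj₁ c₁<Y₂₃)
            }
          where
          flip : ∀ n₁ n₂ x y → n₂ * x - n₁ * y ≡ - (n₁ * y - n₂ * x)
          flip = solve-∀
          add : ∀ u v → - (u - v) + u ≡ v
          add = solve-∀
          -- Across the second column `det₂` is read with the opposite sign: c₃ Y₂₃ is that
          -- nonnegative determinant plus c₁ Y₁₂.
          0≤c₃ : 0ℤ ≤ c₃
          0≤c₃ = 0≤i*j⇒0≤i 0<Y₂₃ (subst (0ℤ ≤_) (add (c₁ * Y₁₂) (c₃ * Y₂₃))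
            (ℤ.+-mono-≤ (subst (0ℤ ≤_) (trans (flip n₁ n₂ x₂ y₂) (cong -_ (det₂ comb))) 0≤L₂)
                        (0≤i*j 0≤c₁ (ℤ.<⇒≤ 0<Y₁₂))))

      count₁ : ∀ n₁ n₂ → 0ℤ ≤ n₂ * x₁ - n₁ * y₁ → 0ℤ ≤ n₁ * y₂ - n₂ * x₂ → Count₁ n₁ n₂
      count₁ n₁ n₂ =
        let _ , _ , _ , comb₀ = ∃-combination n₁ n₂
            _ , _ , _ , comb , 0≤c₃ , c₃<Y₁₂ = reduce₃ comb₀
        in count-reduced₃ comb 0≤c₃ c₃<Y₁₂

      count₂ : ∀ n₁ n₂ → 0ℤ ≤ n₁ * y₃ - n₂ * x₃ → 0ℤ ≤ n₂ * x₂ - n₁ * y₂ → Count₂ n₁ n₂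
      count₂ n₁ n₂ =
        let _ , _ , _ , comb₀ = ∃-combination n₁ n₂
            _ , _ , _ , comb , 0≤c₁ , c₁<Y₂₃ = reduce₁ comb₀
        in count-reduced₁ comb 0≤c₁ c₁<Y₂₃

-- Residues of the coordinates and the resulting formula.

-- Modulo `d` the term `z * d` vanishes and `h * F` is 1.
∣-residue : ∀ h F d c z → InverseMod h F d → d ∣ h * (c * F + z * d) - c
∣-residue h F d c z (divides κ hF-1≡κd) = divides (c * κ + h * z) (begin
  h * (c * F + z * d) - c              ≡⟨ split h F d c z ⟩
  c * (h * F - 1ℤ) + h * z * d         ≡⟨ cong (λ u → c * u + h * z * d) hF-1≡κd ⟩
  c * (κ * d) + h * z * d              ≡⟨ join h d c z κ ⟩
  (c * κ + h * z) * d                  ∎)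
  where
  open ≡-Reasoning
  split : ∀ h F d c z → h * (c * F + z * d) - c ≡ c * (h * F - 1ℤ) + h * z * d
  split = solve-∀
  join : ∀ h d c z κ → c * (κ * d) + h * z * d ≡ (c * κ + h * z) * d
  join = solve-∀

module _ (x₁ x₂ x₃ y₁ y₂ y₃ : ℤ) where
  open Columns x₁ x₂ x₃ y₁ y₂ y₃

  module _ {n₁ n₂ c₁ c₂ c₃ : ℤ} (comb : Combination n₁ n₂ c₁ c₂ c₃) where

    -- The bracket is `f` times the left side of `det₁` minus `g` times that of `det₂`. Modulo `Y₁₂`
    -- only `c₃` survives, with the coefficient that `h` inverts.
    residue₁₂ : ∀ f g h → InverseMod h (f * Y₁₃ + g * Y₂₃) Y₁₂ →
      Y₁₂ ∣ h * (n₂ * (f * x₁ + g * x₂) - n₁ * (f * y₁ + g * y₂)) - c₃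
    residue₁₂ f g h inv = subst (λ u → Y₁₂ ∣ h * u - c₃) (sym eq)
      (∣-residue h (f * Y₁₃ + g * Y₂₃) Y₁₂ c₃ (f * c₂ - g * c₁) inv)
      where
      open ≡-Reasoning
      split : ∀ f g n₁ n₂ x₁ y₁ x₂ y₂ → n₂ * (f * x₁ + g * x₂) - n₁ * (f * y₁ + g * y₂) ≡
              f * (n₂ * x₁ - n₁ * y₁) - g * (n₁ * y₂ - n₂ * x₂)
      split = solve-∀
      collect : ∀ f g c₁ c₂ c₃ Y₁₂ Y₁₃ Y₂₃ → f * (c₂ * Y₁₂ + c₃ * Y₁₃) - g * (c₁ * Y₁₂ - c₃ * Y₂₃) ≡
                c₃ * (f * Y₁₃ + g * Y₂₃) + (f * c₂ - g * c₁) * Y₁₂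
      collect = solve-∀
      eq : n₂ * (f * x₁ + g * x₂) - n₁ * (f * y₁ + g * y₂) ≡ c₃ * (f * Y₁₃ + g * Y₂₃) + (f * c₂ - g * c₁) * Y₁₂
      eq = begin
        n₂ * (f * x₁ + g * x₂) - n₁ * (f * y₁ + g * y₂)
          ≡⟨ split f g n₁ n₂ x₁ y₁ x₂ y₂ ⟩
        f * (n₂ * x₁ - n₁ * y₁) - g * (n₁ * y₂ - n₂ * x₂)
          ≡⟨ cong₂ (λ u v → f * u - g * v) (det₁ comb) (det₂ comb) ⟩
        f * (c₂ * Y₁₂ + c₃ * Y₁₃) - g * (c₁ * Y₁₂ - c₃ * Y₂₃)
          ≡⟨ collect f g c₁ c₂ c₃ Y₁₂ Y₁₃ Y₂₃ ⟩
        c₃ * (f * Y₁₃ + g * Y₂₃) + (f * c₂ - g * c₁) * Y₁₂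
          ∎

    -- Here `det₃` and `det₂` are combined, and modulo `Y₂₃` only `c₁` survives.
    residue₂₃ : ∀ f g h → InverseMod h (f * Y₁₃ + g * Y₁₂) Y₂₃ →
      Y₂₃ ∣ h * (n₁ * (f * y₃ + g * y₂) - n₂ * (f * x₃ + g * x₂)) - c₁
    residue₂₃ f g h inv = subst (λ u → Y₂₃ ∣ h * u - c₁) (sym eq)
      (∣-residue h (f * Y₁₃ + g * Y₁₂) Y₂₃ c₁ (f * c₂ - g * c₃) inv)
      where
      open ≡-Reasoning
      split : ∀ f g n₁ n₂ x₃ y₃ x₂ y₂ → n₁ * (f * y₃ + g * y₂) - n₂ * (f * x₃ + g * x₂) ≡
              f * (n₁ * y₃ - n₂ * x₃) + g * (n₁ * y₂ - n₂ * x₂)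
      split = solve-∀
      collect : ∀ f g c₁ c₂ c₃ Y₁₂ Y₁₃ Y₂₃ → f * (c₁ * Y₁₃ + c₂ * Y₂₃) + g * (c₁ * Y₁₂ - c₃ * Y₂₃) ≡
                c₁ * (f * Y₁₃ + g * Y₁₂) + (f * c₂ - g * c₃) * Y₂₃
      collect = solve-∀
      eq : n₁ * (f * y₃ + g * y₂) - n₂ * (f * x₃ + g * x₂) ≡ c₁ * (f * Y₁₃ + g * Y₁₂) + (f * c₂ - g * c₃) * Y₂₃
      eq = begin
        n₁ * (f * y₃ + g * y₂) - n₂ * (f * x₃ + g * x₂)
          ≡⟨ split f g n₁ n₂ x₃ y₃ x₂ y₂ ⟩
        f * (n₁ * y₃ - n₂ * x₃) + g * (n₁ * y₂ - n₂ * x₂)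
          ≡⟨ cong₂ (λ u v → f * u + g * v) (det₃ comb) (det₂ comb) ⟩
        f * (c₁ * Y₁₃ + c₂ * Y₂₃) + g * (c₁ * Y₁₂ - c₃ * Y₂₃)
          ≡⟨ collect f g c₁ c₂ c₃ Y₁₂ Y₁₃ Y₂₃ ⟩
        c₁ * (f * Y₁₃ + g * Y₁₂) + (f * c₂ - g * c₃) * Y₂₃
          ∎

    -- Here `det₁` and `det₃` are combined. In f det₁ - g det₃ the coefficient of `c₂` is f Y₁₂ - g
    -- Y₂₃, which is where the reversed minor `Y₃₂` comes from.
    residue₁₃ : ∀ f g h → InverseMod h (f * Y₁₂ + g * Y₃₂) Y₁₃ →
      Y₁₃ ∣ h * (n₂ * (f * x₁ + g * x₃) - n₁ * (f * y₁ + g * y₃)) - c₂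
    residue₁₃ f g h inv = subst (λ u → Y₁₃ ∣ h * u - c₂) (sym eq)
      (∣-residue h (f * Y₁₂ + g * Y₃₂) Y₁₃ c₂ (f * c₃ - g * c₁) inv)
      where
      open ≡-Reasoning
      split : ∀ f g n₁ n₂ x₁ y₁ x₃ y₃ → n₂ * (f * x₁ + g * x₃) - n₁ * (f * y₁ + g * y₃) ≡
              f * (n₂ * x₁ - n₁ * y₁) - g * (n₁ * y₃ - n₂ * x₃)
      split = solve-∀
      -- `Y₂₃` and `Y₃₂` are spelled out because the ring solver sees that they are opposite only
      -- through the entries.
      collect : ∀ f g c₁ c₂ c₃ x₂ y₂ x₃ y₃ Y₁₂ Y₁₃ →
        f * (c₂ * Y₁₂ + c₃ * Y₁₃) - g * (c₁ * Y₁₃ + c₂ * (x₂ * y₃ - x₃ * y₂)) ≡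
        c₂ * (f * Y₁₂ + g * (x₃ * y₂ - x₂ * y₃)) + (f * c₃ - g * c₁) * Y₁₃
      collect = solve-∀
      eq : n₂ * (f * x₁ + g * x₃) - n₁ * (f * y₁ + g * y₃) ≡ c₂ * (f * Y₁₂ + g * Y₃₂) + (f * c₃ - g * c₁) * Y₁₃
      eq = begin
        n₂ * (f * x₁ + g * x₃) - n₁ * (f * y₁ + g * y₃)
          ≡⟨ split f g n₁ n₂ x₁ y₁ x₃ y₃ ⟩
        f * (n₂ * x₁ - n₁ * y₁) - g * (n₁ * y₃ - n₂ * x₃)
          ≡⟨ cong₂ (λ u v → f * u - g * v) (det₁ comb) (det₃ comb) ⟩
        f * (c₂ * Y₁₂ + c₃ * Y₁₃) - g * (c₁ * Y₁₃ + c₂ * Y₂₃)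
          ≡⟨ collect f g c₁ c₂ c₃ x₂ y₂ x₃ y₃ Y₁₂ Y₁₃ ⟩
        c₂ * (f * Y₁₂ + g * Y₃₂) + (f * c₃ - g * c₁) * Y₁₃
          ∎

-- Needed because `residue₁₃` concerns `c₂`, while the fractional part requires its representative
-- `s` in [0, Y₁₃).
∣-shift : ∀ d e c s t → c + d ≡ s + t * d → d ∣ e - c → d ∣ e - s
∣-shift d e c s t c+d≡s+td (divides κ e-c≡κd) = divides (κ + t - 1ℤ) (begin
  e - s                            ≡⟨ insert d e c s ⟩
  (e - c) + ((c + d) - s - d)      ≡⟨ cong₂ (λ u v → u + (v - s - d)) e-c≡κd c+d≡s+td ⟩
  κ * d + ((s + t * d) - s - d)    ≡⟨ collect d κ s t ⟩
  (κ + t - 1ℤ) * d                 ∎)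
  where
  open ≡-Reasoning
  insert : ∀ d e c s → e - s ≡ (e - c) + ((c + d) - s - d)
  insert = solve-∀
  collect : ∀ d κ s t → κ * d + ((s + t * d) - s - d) ≡ (κ + t - 1ℤ) * d
  collect = solve-∀

-- Common to both sectors: `E` is `Y₁₃`, while `D` and `c` are `Y₁₂` and `c₃` on the first, `Y₂₃`
-- and `c₁` on the second. Multiplying t E = c₂ + E - s by `D` and replacing `c₂ * D` by `L - c * E`
-- gives the cleared form.
frac-formula : ∀ L D E c c₂ s t e₁ e₂ .{{_ : NonZero D}} .{{_ : NonZero E}} .{{_ : NonZero (D * E)}} →
  0ℤ < D → 0ℤ < E → L ≡ c₂ * D + c * E → c₂ + E ≡ s + t * E →
  0ℤ ≤ c → c < D → 0ℤ ≤ s → s < E → D ∣ e₁ - c → E ∣ e₂ - c₂ →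
  ι t ≡ L ⁄ (D * E) ℚ.- frac (e₁ ⁄ D) ℚ.- frac (e₂ ⁄ E) ℚ.+ 1ℚ
frac-formula L D E c c₂ s t e₁ e₂ 0<D 0<E L≡ c₂+E≡ 0≤c c<D 0≤s s<E D∣ E∣ =
  trans (⁄-formula L D E c s t 0<D 0<E t≡)
    (sym (cong₂ (λ u v → L ⁄ (D * E) ℚ.- u ℚ.- v ℚ.+ 1ℚ)
      (frac-⁄ e₁ D c 0<D 0≤c c<D D∣)
      (frac-⁄ e₂ E s 0<E 0≤s s<E (∣-shift E e₂ c₂ s t c₂+E≡ E∣))))
  where
  open ≡-Reasoning
  expand : ∀ s t D E → t * (D * E) ≡ (s + t * E - s) * D
  expand = solve-∀
  collect : ∀ c₂ c s D E → (c₂ + E - s) * D ≡ c₂ * D + c * E - c * E - s * D + D * E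
  collect = solve-∀
  t≡ : t * (D * E) ≡ L - c * E - s * D + D * E
  t≡ = begin
    t * (D * E)                                 ≡⟨ expand s t D E ⟩
    (s + t * E - s) * D                         ≡⟨ cong (λ u → (u - s) * D) c₂+E≡ ⟨
    (c₂ + E - s) * D                            ≡⟨ collect c₂ c s D E ⟩
    c₂ * D + c * E - c * E - s * D + D * E      ≡⟨ cong (λ u → u - c * E - s * D + D * E) L≡ ⟨
    L - c * E - s * D + D * E                   ∎

-- Sectors and their closures inside half planes.

-- The product of `x` and `u` is a common multiple of both slope denominators and is nonnegative
-- even when both are negative, so multiplying by it turns a slope comparison into a linear
-- inequality.
module _ (x y : ℤ) (u v : ℚ) .{{_ : NonZero x}} {{u≢0 : ℚ.NonZero u}} (0≤xu : 0ℚ ℚ.≤ ι x ℚ.* u) where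

  private
    open ℚ.+-*-Solver
    open ≡-Reasoning

    slope-xu : (v ℚ.÷ u) ℚ.* (ι x ℚ.* u) ≡ ι x ℚ.* v
    slope-xu = begin
      v ℚ.* ℚ.1/ u ℚ.* (ι x ℚ.* u)     ≡⟨ solve 4 (λ v w x u → v :* w :* (x :* u) := x :* v :* (w :* u)) refl v (ℚ.1/ u) (ι x) u ⟩
      ι x ℚ.* v ℚ.* (ℚ.1/ u ℚ.* u)     ≡⟨ cong (ι x ℚ.* v ℚ.*_) (ℚ.*-inverseˡ u) ⟩
      ι x ℚ.* v ℚ.* 1ℚ                 ≡⟨ ℚ.*-identityʳ (ι x ℚ.* v) ⟩
      ι x ℚ.* v                        ∎

    y⁄x-xu : (y ⁄ x) ℚ.* (ι x ℚ.* u) ≡ ι y ℚ.* u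
    y⁄x-xu = trans (sym (ℚ.*-assoc (y ⁄ x) (ι x) u)) (cong (ℚ._* u) (⁄-*-cancel y x))

    0≤q-p : ∀ {p q} → p ℚ.≤ q → 0ℚ ℚ.≤ q ℚ.- p
    0≤q-p {p} {q} p≤q = subst (ℚ._≤ q ℚ.- p) (ℚ.+-inverseʳ p) (ℚ.+-monoˡ-≤ (ℚ.- p) p≤q)

    scale : ∀ {p q} → p ℚ.< q → p ℚ.* (ι x ℚ.* u) ℚ.≤ q ℚ.* (ι x ℚ.* u)
    scale p<q = ℚ.*-monoʳ-≤-nonNeg (ι x ℚ.* u) {{ℚ.nonNegative 0≤xu}} (ℚ.<⇒≤ p<q)

  above-slope : y ⁄ x ℚ.< v ℚ.÷ u → 0ℚ ℚ.≤ ι (- y) ℚ.* u ℚ.+ ι x ℚ.* v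
  above-slope s<slope = subst (0ℚ ℚ.≤_) (begin
    ι x ℚ.* v ℚ.- ι y ℚ.* u            ≡⟨ solve 4 (λ x v y u → x :* v :- y :* u := (:- y) :* u :+ x :* v) refl (ι x) v (ι y) u ⟩
    (ℚ.- ι y) ℚ.* u ℚ.+ ι x ℚ.* v      ≡⟨ cong (λ w → w ℚ.* u ℚ.+ ι x ℚ.* v) (ι-neg y) ⟨
    ι (- y) ℚ.* u ℚ.+ ι x ℚ.* v        ∎)
    (0≤q-p (subst₂ ℚ._≤_ y⁄x-xu slope-xu (scale s<slope)))

  below-slope : v ℚ.÷ u ℚ.< y ⁄ x → 0ℚ ℚ.≤ ι y ℚ.* u ℚ.+ ι (- x) ℚ.* v
  below-slope slope<t = subst (0ℚ ℚ.≤_) (begin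
    ι y ℚ.* u ℚ.- ι x ℚ.* v            ≡⟨ solve 4 (λ x v y u → y :* u :- x :* v := y :* u :+ (:- x) :* v) refl (ι x) v (ι y) u ⟩
    ι y ℚ.* u ℚ.+ (ℚ.- ι x) ℚ.* v      ≡⟨ cong (λ w → ι y ℚ.* u ℚ.+ w ℚ.* v) (ι-neg x) ⟨
    ι y ℚ.* u ℚ.+ ι (- x) ℚ.* v        ∎)
    (0≤q-p (subst₂ ℚ._≤_ slope-xu y⁄x-xu (scale slope<t)))

0≤p*q : ∀ {p q} → 0ℚ ℚ.≤ p → 0ℚ ℚ.≤ q → 0ℚ ℚ.≤ p ℚ.* q
0≤p*q {p} {q} 0≤p 0≤q = ℚ.nonNegative⁻¹ (p ℚ.* q)
  {{ℚ.nonNeg*nonNeg⇒nonNeg p {{ℚ.nonNegative 0≤p}} q {{ℚ.nonNegative 0≤q}}}}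

-- With `c` an entry of the first row, this puts the cone on the same side of the vertical axis as
-- the columns, and so supplies the hypothesis `0≤xu`.
cone-nonNeg : ∀ {x₁ x₂ x₃} {ys : Vec ℤ 3} {u v} c → 0ℤ ≤ c * x₁ → 0ℤ ≤ c * x₂ → 0ℤ ≤ c * x₃ →
  (u ∷ v ∷ []) ∈ Cone ((x₁ ∷ x₂ ∷ x₃ ∷ []) ∷ ys ∷ []) → 0ℚ ℚ.≤ ι c ℚ.* u
cone-nonNeg {x₁} {x₂} {x₃} c 0≤cx₁ 0≤cx₂ 0≤cx₃ (w₁ ∷ w₂ ∷ w₃ ∷ [] , 0≤w₁ All.∷ 0≤w₂ All.∷ 0≤w₃ All.∷ All.[] , refl) =
  subst (0ℚ ℚ.≤_) (begin
    ι (c * x₁) ℚ.* w₁ ℚ.+ (ι (c * x₂) ℚ.* w₂ ℚ.+ ι (c * x₃) ℚ.* w₃)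
      ≡⟨ cong₂ ℚ._+_ (cong (ℚ._* w₁) (ι-* c x₁)) (cong₂ ℚ._+_ (cong (ℚ._* w₂) (ι-* c x₂)) (cong (ℚ._* w₃) (ι-* c x₃))) ⟩
    ι c ℚ.* ι x₁ ℚ.* w₁ ℚ.+ (ι c ℚ.* ι x₂ ℚ.* w₂ ℚ.+ ι c ℚ.* ι x₃ ℚ.* w₃)
      ≡⟨ solve 7 (λ c x₁ x₂ x₃ w₁ w₂ w₃ → c :* x₁ :* w₁ :+ (c :* x₂ :* w₂ :+ c :* x₃ :* w₃) :=
           c :* (x₁ :* w₁ :+ (x₂ :* w₂ :+ (x₃ :* w₃ :+ con 0ℚ)))) refl (ι c) (ι x₁) (ι x₂) (ι x₃) w₁ w₂ w₃ ⟩
    ι c ℚ.* (ι x₁ ℚ.* w₁ ℚ.+ (ι x₂ ℚ.* w₂ ℚ.+ (ι x₃ ℚ.* w₃ ℚ.+ 0ℚ)))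
      ∎)
    (ℚ.+-mono-≤ (term 0≤cx₁ 0≤w₁) (ℚ.+-mono-≤ (term 0≤cx₂ 0≤w₂) (term 0≤cx₃ 0≤w₃)))
  where
  open ≡-Reasoning
  open ℚ.+-*-Solver
  term : ∀ {a w} → 0ℤ ≤ a → 0ℚ ℚ.≤ w → 0ℚ ℚ.≤ ι a ℚ.* w
  term 0≤a 0≤w = 0≤p*q (ι-mono-≤ 0≤a) 0≤w

module _ {x₁ x₂ x₃ : ℤ} {ys : Vec ℤ 3} (x y : ℤ) .{{_ : NonZero x}}
         (0≤xx₁ : 0ℤ ≤ x * x₁) (0≤xx₂ : 0ℤ ≤ x * x₂) (0≤xx₃ : 0ℤ ≤ x * x₃) (n₁ n₂ : ℤ) where

  private
    M : Matrix ℤ 2 3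
    M = (x₁ ∷ x₂ ∷ x₃ ∷ []) ∷ ys ∷ []

  closure-above : ∀ {t} → map ι (n₁ ∷ n₂ ∷ []) ∈ Closure (Sector M (y ⁄ x) t) → 0ℤ ≤ n₂ * x - n₁ * y
  closure-above n∈S̄ = subst (0ℤ ≤_) (swap x y n₁ n₂)
    (closure-halfPlane (- y) x
      (λ u v (uv∈C , u≢0 , s<slope , _) →
        above-slope x y u v {{u≢0 = u≢0}} (cone-nonNeg {ys = ys} x 0≤xx₁ 0≤xx₂ 0≤xx₃ uv∈C) s<slope)
      n₁ n₂ n∈S̄)
    where
    swap : ∀ x y n₁ n₂ → - y * n₁ + x * n₂ ≡ n₂ * x - n₁ * y
    swap = solve-∀

  closure-below : ∀ {s} → map ι (n₁ ∷ n₂ ∷ []) ∈ Closure (Sector M s (y ⁄ x)) → 0ℤ ≤ n₁ * y - n₂ * x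
  closure-below n∈S̄ = subst (0ℤ ≤_) (swap x y n₁ n₂)
    (closure-halfPlane y (- x)
      (λ u v (uv∈C , u≢0 , _ , slope<t) →
        below-slope x y u v {{u≢0 = u≢0}} (cone-nonNeg {ys = ys} x 0≤xx₁ 0≤xx₂ 0≤xx₃ uv∈C) slope<t)
      n₁ n₂ n∈S̄)
    where
    swap : ∀ x y n₁ n₂ → y * n₁ + - x * n₂ ≡ n₁ * y - n₂ * x
    swap = solve-∀

0≤i*i : ∀ i → 0ℤ ≤ i * i
0≤i*i (+ n)      = 0≤i*j {+ n} {+ n} (ℤ.+≤+ ℕ.z≤n) (ℤ.+≤+ ℕ.z≤n)
0≤i*i ℤ.-[1+ n ] = ℤ.+≤+ ℕ.z≤n

-- The product of the two hypotheses is `i * k` times the square of `j`.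
0<i*j-trans : ∀ i j k → 0ℤ < i * j → 0ℤ < j * k → 0ℤ < i * k
0<i*j-trans i j k 0<ij 0<jk = ℤ.*-cancelʳ-<-nonNeg {0ℤ} {i * k} (j * j) {{ℤ.nonNegative (0≤i*i j)}}
  (subst (0ℤ <_) (regroup i j k) (0<i*j 0<ij 0<jk))
  where
  regroup : ∀ i j k → i * j * (j * k) ≡ i * k * (j * j)
  regroup = solve-∀

theorem7 :
  ∀ (x₁ x₂ x₃ y₁ y₂ y₃ : ℤ)
    .{{_ : NonZero x₁}} .{{_ : NonZero x₂}} .{{_ : NonZero x₃}} →
  let M   = (x₁ ∷ x₂ ∷ x₃ ∷ []) ∷ (y₁ ∷ y₂ ∷ y₃ ∷ []) ∷ []
      Y₁₂ = x₁ * y₂ - x₂ * y₁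
      Y₁₃ = x₁ * y₃ - x₃ * y₁
      Y₂₃ = x₂ * y₃ - x₃ * y₂
      Y₃₂ = x₃ * y₂ - x₂ * y₃
  in
  replicate 2 0ℚ ∉ ConvexHull M →
  0ℤ < x₁ * x₂ → 0ℤ < x₂ * x₃ →
  (s₁<s₂ : y₁ ⁄ x₁ ℚ.< y₂ ⁄ x₂) (s₂<s₃ : y₂ ⁄ x₂ ℚ.< y₃ ⁄ x₃) →
  OnePrime M →
  ∀ (f₁₂ g₁₂ f₁₃ g₁₃ f₂₃ g₂₃ : ℤ) →
  gcd (f₁₂ * Y₁₃ + g₁₂ * Y₂₃) Y₁₂ ≡ 1ℤ →
  gcd (f₁₃ * Y₁₂ + g₁₃ * Y₃₂) Y₁₃ ≡ 1ℤ →
  gcd (f₂₃ * Y₁₃ + g₂₃ * Y₁₂) Y₂₃ ≡ 1ℤ →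
  ∀ (h₁₂ h₁₃ h₂₃ : ℤ) →
  InverseMod h₁₂ (f₁₂ * Y₁₃ + g₁₂ * Y₂₃) Y₁₂ →
  InverseMod h₁₃ (f₁₃ * Y₁₂ + g₁₃ * Y₃₂) Y₁₃ →
  InverseMod h₂₃ (f₂₃ * Y₁₃ + g₂₃ * Y₁₂) Y₂₃ →
  ∀ (n₁ n₂ : ℤ) →
  let n  = n₁ ∷ n₂ ∷ []
      Ω₁ = Sector M (y₁ ⁄ x₁) (y₂ ⁄ x₂)
      Ω₂ = Sector M (y₂ ⁄ x₂) (y₃ ⁄ x₃)
      instance
        Y₁₂≢0 : NonZero Y₁₂
        Y₁₂≢0 = minor-nonZero x₁ y₁ x₂ y₂ s₁<s₂
        Y₁₃≢0 : NonZero Y₁₃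
        Y₁₃≢0 = minor-nonZero x₁ y₁ x₃ y₃ (<-trans s₁<s₂ s₂<s₃)
        Y₂₃≢0 : NonZero Y₂₃
        Y₂₃≢0 = minor-nonZero x₂ y₂ x₃ y₃ s₂<s₃
        Y₁₂Y₁₃≢0 : NonZero (Y₁₂ * Y₁₃)
        Y₁₂Y₁₃≢0 = i*j≢0 Y₁₂ Y₁₃
        Y₂₃Y₁₃≢0 : NonZero (Y₂₃ * Y₁₃)
        Y₂₃Y₁₃≢0 = i*j≢0 Y₂₃ Y₁₃
  in
  (map ι n ∈ Closure Ω₁ →
    ∃ λ t → PartitionCount M n t ×
      ι (+ t) ≡
        (n₂ * x₁ - n₁ * y₁) ⁄ (Y₁₂ * Y₁₃)
          ℚ.- frac ((h₁₂ * (n₂ * (f₁₂ * x₁ + g₁₂ * x₂) - n₁ * (f₁₂ * y₁ + g₁₂ * y₂))) ⁄ Y₁₂)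
          ℚ.- frac ((h₁₃ * (n₂ * (f₁₃ * x₁ + g₁₃ * x₃) - n₁ * (f₁₃ * y₁ + g₁₃ * y₃))) ⁄ Y₁₃)
          ℚ.+ 1ℚ)
  ×
  (map ι n ∈ Closure Ω₂ →
    ∃ λ t → PartitionCount M n t ×
      ι (+ t) ≡
        (n₁ * y₃ - n₂ * x₃) ⁄ (Y₂₃ * Y₁₃)
          ℚ.- frac ((h₂₃ * (n₁ * (f₂₃ * y₃ + g₂₃ * y₂) - n₂ * (f₂₃ * x₃ + g₂₃ * x₂))) ⁄ Y₂₃)
          ℚ.- frac ((h₁₃ * (n₂ * (f₁₃ * x₁ + g₁₃ * x₃) - n₁ * (f₁₃ * y₁ + g₁₃ * y₃))) ⁄ Y₁₃)
          ℚ.+ 1ℚ)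
theorem7 x₁ x₂ x₃ y₁ y₂ y₃ {{x₁≢0}} {{x₂≢0}} {{x₃≢0}} _ 0<x₁x₂ 0<x₂x₃ s₁<s₂ s₂<s₃ oneprime
  f₁₂ g₁₂ f₁₃ g₁₃ f₂₃ g₂₃ _ _ _ h₁₂ h₁₃ h₂₃ inv₁₂ inv₁₃ inv₂₃ n₁ n₂ = part₁ , part₂
  where
  open Columns x₁ x₂ x₃ y₁ y₂ y₃

  0<x₁x₃ : 0ℤ < x₁ * x₃
  0<x₁x₃ = 0<i*j-trans x₁ x₂ x₃ 0<x₁x₂ 0<x₂x₃

  0<Y₁₂ : 0ℤ < Y₁₂
  0<Y₁₂ = ⁄<⁄⇒< x₁ y₁ x₂ y₂ 0<x₁x₂ s₁<s₂

  0<Y₁₃ : 0ℤ < Y₁₃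
  0<Y₁₃ = ⁄<⁄⇒< x₁ y₁ x₃ y₃ 0<x₁x₃ (<-trans s₁<s₂ s₂<s₃)

  0<Y₂₃ : 0ℤ < Y₂₃
  0<Y₂₃ = ⁄<⁄⇒< x₂ y₂ x₃ y₃ 0<x₂x₃ s₂<s₃

  -- These proofs differ from the ones in the statement, but `_⁄_` takes its instance irrelevantly,
  -- so the quotients are the same terms.
  instance
    Y₁₂≢0 : NonZero Y₁₂
    Y₁₂≢0 = ℤ.>-nonZero 0<Y₁₂
    Y₁₃≢0 : NonZero Y₁₃
    Y₁₃≢0 = ℤ.>-nonZero 0<Y₁₃
    Y₂₃≢0 : NonZero Y₂₃
    Y₂₃≢0 = ℤ.>-nonZero 0<Y₂₃
    Y₁₂Y₁₃≢0 : NonZero (Y₁₂ * Y₁₃)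
    Y₁₂Y₁₃≢0 = i*j≢0 Y₁₂ Y₁₃
    Y₂₃Y₁₃≢0 : NonZero (Y₂₃ * Y₁₃)
    Y₂₃Y₁₃≢0 = i*j≢0 Y₂₃ Y₁₃

  gcd≡1 : ∃ λ p → ∃₂ λ q r → p * Y₁₂ + q * Y₁₃ + r * Y₂₃ ≡ 1ℤ
  gcd≡1 = bézout₃ Y₁₂ Y₁₃ Y₂₃ (trans (sym (foldr-gcd-filter (ℤ.∣ Y₁₂ ∣ ∷ ℤ.∣ Y₁₃ ∣ ∷ ℤ.∣ Y₂₃ ∣ ∷ []))) oneprime)

  open Unimodular (proj₁ gcd≡1) (proj₁ (proj₂ gcd≡1)) (proj₁ (proj₂ (proj₂ gcd≡1))) (proj₂ (proj₂ (proj₂ gcd≡1)))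
  open Counting 0<Y₁₂ 0<Y₁₃ 0<Y₂₃

  flip : ∀ i j → 0ℤ < i * j → 0ℤ ≤ j * i
  flip i j 0<ij = subst (0ℤ ≤_) (ℤ.*-comm i j) (ℤ.<⇒≤ 0<ij)

  n : Vec ℤ 2
  n = n₁ ∷ n₂ ∷ []

  part₁ : map ι n ∈ Closure (Sector M (y₁ ⁄ x₁) (y₂ ⁄ x₂)) →
    ∃ λ t → PartitionCount M n t ×
      ι (+ t) ≡
        (n₂ * x₁ - n₁ * y₁) ⁄ (Y₁₂ * Y₁₃)
          ℚ.- frac ((h₁₂ * (n₂ * (f₁₂ * x₁ + g₁₂ * x₂) - n₁ * (f₁₂ * y₁ + g₁₂ * y₂))) ⁄ Y₁₂)
          ℚ.- frac ((h₁₃ * (n₂ * (f₁₃ * x₁ + g₁₃ * x₃) - n₁ * (f₁₃ * y₁ + g₁₃ * y₃))) ⁄ Y₁₃)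
          ℚ.+ 1ℚ
  part₁ n∈Ω̄₁ = t , counts ,
    frac-formula _ Y₁₂ Y₁₃ c₃ c₂ s (+ t) _ _ 0<Y₁₂ 0<Y₁₃ (det₁ comb) c₂+Y₁₃≡s+tY₁₃
      (proj₁ reduced) (proj₂ reduced) 0≤s s<Y₁₃
      (residue₁₂ x₁ x₂ x₃ y₁ y₂ y₃ comb f₁₂ g₁₂ h₁₂ inv₁₂)
      (residue₁₃ x₁ x₂ x₃ y₁ y₂ y₃ comb f₁₃ g₁₃ h₁₃ inv₁₃)
    where
    open Count (count₁ n₁ n₂
      (closure-above x₁ y₁ (0≤i*i x₁) (ℤ.<⇒≤ 0<x₁x₂) (ℤ.<⇒≤ 0<x₁x₃) n₁ n₂ n∈Ω̄₁)
      (closure-below x₂ y₂ (flip x₁ x₂ 0<x₁x₂) (0≤i*i x₂) (ℤ.<⇒≤ 0<x₂x₃) n₁ n₂ n∈Ω̄₁))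

  part₂ : map ι n ∈ Closure (Sector M (y₂ ⁄ x₂) (y₃ ⁄ x₃)) →
    ∃ λ t → PartitionCount M n t ×
      ι (+ t) ≡
        (n₁ * y₃ - n₂ * x₃) ⁄ (Y₂₃ * Y₁₃)
          ℚ.- frac ((h₂₃ * (n₁ * (f₂₃ * y₃ + g₂₃ * y₂) - n₂ * (f₂₃ * x₃ + g₂₃ * x₂))) ⁄ Y₂₃)
          ℚ.- frac ((h₁₃ * (n₂ * (f₁₃ * x₁ + g₁₃ * x₃) - n₁ * (f₁₃ * y₁ + g₁₃ * y₃))) ⁄ Y₁₃)
          ℚ.+ 1ℚ
  part₂ n∈Ω̄₂ = t , counts ,
    frac-formula _ Y₂₃ Y₁₃ c₁ c₂ s (+ t) _ _ 0<Y₂₃ 0<Y₁₃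
      (trans (det₃ comb) (ℤ.+-comm (c₁ * Y₁₃) (c₂ * Y₂₃))) c₂+Y₁₃≡s+tY₁₃
      (proj₁ reduced) (proj₂ reduced) 0≤s s<Y₁₃
      (residue₂₃ x₁ x₂ x₃ y₁ y₂ y₃ comb f₂₃ g₂₃ h₂₃ inv₂₃)
      (residue₁₃ x₁ x₂ x₃ y₁ y₂ y₃ comb f₁₃ g₁₃ h₁₃ inv₁₃)
    where
    open Count (count₂ n₁ n₂
      (closure-below x₃ y₃ (flip x₁ x₃ 0<x₁x₃) (flip x₂ x₃ 0<x₂x₃) (0≤i*i x₃) n₁ n₂ n∈Ω̄₂)
      (closure-above x₂ y₂ (flip x₁ x₂ 0<x₁x₂) (0≤i*i x₂) (ℤ.<⇒≤ 0<x₂x₃) n₁ n₂ n∈Ω̄₂))
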